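{- For every integer $r\geq 6$ there exists $n_0=n_0(r)$ such that if $H$ is a connected bipartite graph on $n\geq n_0$ vertices and $H$ is not a star, then $\widehat{R}_r(H)\geq \frac{r^2}{2304}\beta(H)$.
   Context: Graphs are finite and simple. The $r$-color size-Ramsey number $\widehat{R}_r(H)$ of a graph $H$ is the minimum number of edges in a graph $G$ having the property that every $r$-coloring of the edges of $G$ contains a monochromatic copy of $H$ (as a not necessarily induced subgraph). A star is a graph of the form $K_{1,k}$. For a connected bipartite graph $H$ with (unique) bipartition $\{V_1,V_2\}$, let $n_i=|V_i|$ and $\Delta_i=\max\{d(v): v\in V_i\}$ for $i\in\{1,2\}$, and define $\beta(H)=n_1\Delta_1+n_2\Delta_2$. -}

module Defs where

open import Data.Fin.Base using (Fin; toℕ)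
import Data.Fin.Properties as Fin
open import Data.Fin.Subset using (Subset; _∈_; ∁; ∣_∣)
open import Data.Fin.Subset.Properties using (_∈?_)
open import Data.List.Base using (List; allFin; cartesianProduct; filter; length; map)
open import Data.List.Extrema.Nat using (max)
open import Data.Nat.Base using (ℕ; _+_; _*_; _≤_; _<_)
open import Data.Nat.Properties using (_≤?_; _<?_; <⇒≱)
open import Data.Product.Base using (Σ-syntax; ∃-syntax; _×_; _,_; proj₁; proj₂)
open import Data.Sum.Base using (_⊎_; inj₁; inj₂)
open import Data.Vec.Base using (tabulate)
open import Function.Bundles using (_↔_; _⇔_; Inverse)
open import Function.Definitions using (Injective)
open import Level using (0ℓ)
open import Relation.Binary.Construct.Closure.ReflexiveTransitive
  renaming (Star to Walk) using ()
open import Relation.Binary.Core using (Rel)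
open import Relation.Binary.Definitions using (Decidable; Irreflexive; Symmetric)
open import Relation.Binary.PropositionalEquality.Core using (_≡_; refl)
open import Relation.Nullary.Decidable.Core using (does; _×-dec_; _⊎-dec_)

record Graph (n : ℕ) : Set₁ where
  infix 4 _~_ _~?_
  field
    _~_    : Rel (Fin n) 0ℓ
    _~?_   : Decidable _~_
    sym    : Symmetric _~_
    irrefl : Irreflexive _≡_ _~_

  neighbours : Fin n → Subset n
  neighbours v = tabulate (λ u → does (v ~? u))

  degree : Fin n → ℕ
  degree v = ∣ neighbours v ∣

  -- Each edge is listed once, with its smaller endpoint first.
  edges : List (Fin n × Fin n)
  edges = filter (λ e → (proj₁ e Fin.<? proj₂ e) ×-dec (proj₁ e ~? proj₂ e))
                 (cartesianProduct (allFin n) (allFin n))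

  edgeCount : ℕ
  edgeCount = length edges

  Connected : Set
  Connected = ∀ u v → Walk _~_ u v

  -- The maximum degree, in the whole graph, of a vertex of S (0 if S is empty).
  maxDegreeIn : Subset n → ℕ
  maxDegreeIn S = max 0 (map degree (filter (_∈? S) (allFin n)))

record Isomorphism {m n : ℕ} (G : Graph m) (H : Graph n) : Set where
  private
    module G = Graph G
    module H = Graph H
  field
    bijection : Fin m ↔ Fin n
    adjacency : ∀ u v → (u G.~ v) ⇔ (Inverse.to bijection u H.~ Inverse.to bijection v)

-- The parts are the first a and the last b vertices.
completeBipartite : (a b : ℕ) → Graph (a + b)
completeBipartite a b = record
  { _~_    = λ u v → (toℕ u < a × a ≤ toℕ v) ⊎ (a ≤ toℕ u × toℕ v < a)
  ; _~?_   = λ u v → ((toℕ u <? a) ×-dec (a ≤? toℕ v)) ⊎-dec ((a ≤? toℕ u) ×-dec (toℕ v <? a))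
  ; sym    = λ where
      (inj₁ (p , q)) → inj₂ (q , p)
      (inj₂ (p , q)) → inj₁ (q , p)
  ; irrefl = λ where
      refl (inj₁ (p , q)) → <⇒≱ p q
      refl (inj₂ (p , q)) → <⇒≱ q p
  }

IsStar : ∀ {n} → Graph n → Set
IsStar H = ∃[ k ] Isomorphism H (completeBipartite 1 k)

record Bipartition {n : ℕ} (H : Graph n) : Set where
  open Graph H
  field
    V₁ : Subset n

  V₂ : Subset n
  V₂ = ∁ V₁

  field
    crossing : ∀ {u v} → u ~ v → (u ∈ V₁ × v ∈ V₂) ⊎ (u ∈ V₂ × v ∈ V₁)

-- A connected graph has at most one bipartition up to exchanging V₁ and V₂,
-- and β is invariant under that exchange.
β : ∀ {n} (H : Graph n) → Bipartition H → ℕ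
β H P = ∣ V₁ ∣ * maxDegreeIn V₁ + ∣ V₂ ∣ * maxDegreeIn V₂
  where
  open Graph H
  open Bipartition P

-- An adjacency may have several proofs; colour-sym, applied twice, also makes
-- the colour independent of the proof, so this is a colouring of undirected edges.
record EdgeColouring (r : ℕ) {n : ℕ} (G : Graph n) : Set where
  open Graph G
  field
    colour     : ∀ {u v} → u ~ v → Fin r
    colour-sym : ∀ {u v} (e : u ~ v) (e′ : v ~ u) → colour e ≡ colour e′

record Copy {n N : ℕ} (H : Graph n) (G : Graph N) : Set where
  private
    module H = Graph H
    module G = Graph G
  field
    vertex    : Fin n → Fin N
    injective : Injective _≡_ _≡_ vertex
    edge      : ∀ {u v} → u H.~ v → vertex u G.~ vertex v

Monochromatic : ∀ {r n N} {H : Graph n} {G : Graph N} →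
                EdgeColouring r G → Copy H G → Set
Monochromatic {H = H} c φ = ∃[ k ] (∀ {u v} (e : u ~ v) → colour (edge e) ≡ k)
  where
  open Graph H
  open EdgeColouring c
  open Copy φ

Arrows : ∀ {n N} → ℕ → Graph N → Graph n → Set
Arrows r G H = (c : EdgeColouring r G) → Σ[ φ ∈ Copy H G ] Monochromatic c φ

-- m is the r-colour size-Ramsey number of H, as a relation: m is the least
-- element of the set of edge counts of graphs G with Arrows r G H.
record IsSizeRamseyNumber (r : ℕ) {n : ℕ} (H : Graph n) (m : ℕ) : Set₁ where
  field
    attained : ∃[ N ] Σ[ G ∈ Graph N ] (Arrows r G H × Graph.edgeCount G ≡ m)
    minimal  : ∀ {N} (G : Graph N) → Arrows r G H → m ≤ Graph.edgeCount G

{-# OPTIONS --safe #-}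

-- Fix one side of H, with a vertices and maximum degree Δ; it suffices to show that a graph G
-- with E edges, 72 E < K² a Δ, has a 3K-colouring without a monochromatic H, where
-- K = ⌊r/3⌋ ≥ r/4.  A vertex of G is big if its degree is at least K Δ / 4, so there are few
-- big vertices, and they split into K parts of fewer than a vertices each.  With well-chosen
-- shifts of the blocks of such a partition, the numbers d_i(v) of neighbours of a small vertex v
-- in part i have, summed over v, no more variance than for a random partition.  Hence, by
-- Chebyshev, few edges join a small v to a part i that is crowded for v, that is, d_i(v) ≥ Δ,
-- and at most (K − 1)(a − 1) small vertices have more than K neighbours in parts crowded for
-- them.  These vertices are starred and split into classes 1, …, K − 1 of fewer than a vertices
-- each; the class of an unstarred vertex is 0.
--
-- Palette 0 colours the edges between big vertices by a Latin square in their parts, and the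
-- edges between small vertices greedily, with all colour degrees below Δ.  Palette 1 colours an
-- edge from a big s to a small v by a Latin square in the part of s and the class of v, unless
-- v is unstarred and s lies in a part crowded for v; palette 2 gives these remaining edges at v
-- distinct colours.  In a copy of H coloured from palette 1 or inside the big vertices, the
-- Latin squares confine the given side to one part, to one class of starred vertices, or to the
-- unstarred vertices; the first two are too small, and in the last case all neighbours of a
-- vertex of degree Δ lie in one uncrowded part.  Palette 2 contains no copy because both sides
-- of H have vertices of degree at least 2.
module Submission where

open import Defs
import Algebra.Properties.Semiring.Sum as Sum
open import Data.Bool.Base using (Bool; true; false; not; _∧_; _∨_; if_then_else_; T)
open import Data.Bool.Properties using (not-involutive; ¬-not; ∧-comm; ∧-zeroʳ; ∧-conicalˡ; ∧-conicalʳ)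
  renaming (_≟_ to _Bool≟_)
open import Data.Empty using (⊥)
open import Data.Fin.Base using (Fin; zero; suc; toℕ; fromℕ<; combine; remQuot; inject≤)
import Data.Fin.Permutation as Permutation
import Data.Fin.Properties as Fin
open import Data.Fin.Subset using (Subset; inside; outside; ∣_∣; ∁) renaming (_∈_ to _∈ˢ_)
open import Data.Fin.Subset.Properties using (x∈∁p⇒x∉p) renaming (_∈?_ to _∈ˢ?_)
open import Data.List.Base
  using (List; []; _∷_; _++_; allFin; cartesianProduct; filter; length; map; tabulate)
open import Data.List.Extrema.Nat using (argmax-sel; xs≤max)
open import Data.List.Membership.Propositional using (_∈_)
open import Data.List.Membership.Propositional.Properties
  using (∈-cartesianProduct⁺; ∈-allFin; ∈-map⁺; ∈-map⁻; ∈-filter⁺; ∈-filter⁻)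
open import Data.List.Properties using (filter-++; length-++; map-tabulate)
open import Data.List.Relation.Unary.All using () renaming (lookup to All-lookup)
open import Data.List.Relation.Unary.Any using (here; there)
open import Data.Nat.Base
open import Data.Nat.DivMod using (_/_; _%_; m≡m%n+[m/n]*n; m%n<n)
open import Data.Nat.Properties
open import Data.Nat.Tactic.RingSolver using (solve-∀)
open import Data.Product.Base using (∃-syntax; Σ-syntax; _×_; _,_; proj₁; proj₂)
open import Data.Sum.Base using (_⊎_; inj₁; inj₂)
open import Data.Unit.Base using (tt)
open import Data.Vec.Base using ([]; _∷_; lookup)
open import Data.Vec.Properties using (lookup∘tabulate; lookup-map; []=⇒lookup; lookup⇒[]=)
open import Function.Base using (_∘_; case_of_)
open import Function.Bundles using (Inverse; mk⇔)
open import Level using (0ℓ)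
open import Relation.Binary.Construct.Closure.ReflexiveTransitive using (ε; _◅_) renaming (Star to Walk)
open import Relation.Binary.Definitions using (tri<; tri≈; tri>)
open import Relation.Binary.PropositionalEquality
open import Relation.Nullary.Decidable using (yes; no; does; dec-true; dec-false; _×-dec_)
open import Relation.Nullary.Negation using (¬_; contradiction)
open import Relation.Unary using (Pred; Decidable)
open Sum +-*-semiring using (sum; sum-cong-≗; ∑-comm; ∑-distrib-+; *-distribˡ-sum; *-distribʳ-sum)

-- Finite sums and counting.

sum-mono : ∀ {n} {f g : Fin n → ℕ} → (∀ i → f i ≤ g i) → sum f ≤ sum g
sum-mono {zero}  f≤g = z≤n
sum-mono {suc n} f≤g = +-mono-≤ (f≤g zero) (sum-mono (f≤g ∘ suc))

sum-zero : ∀ {n} {f : Fin n → ℕ} → (∀ i → f i ≡ 0) → sum f ≡ 0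
sum-zero {zero}  f≡0 = refl
sum-zero {suc n} f≡0 = cong₂ _+_ (f≡0 zero) (sum-zero (f≡0 ∘ suc))

sum-const : ∀ n c → sum {n} (λ _ → c) ≡ n * c
sum-const zero    c = refl
sum-const (suc n) c = cong (c +_) (sum-const n c)

term≤sum : ∀ {n} (f : Fin n → ℕ) i → f i ≤ sum f
term≤sum f zero    = m≤m+n _ _
term≤sum f (suc i) = ≤-trans (term≤sum (f ∘ suc) i) (m≤n+m _ _)

sum-atMostOne : ∀ {n} (f : Fin n → ℕ) {c} → (∀ i → f i ≤ c) →
  (∀ {i j} → 0 < f i → 0 < f j → i ≡ j) → sum f ≤ c
sum-atMostOne {zero}  f f≤c unique = z≤n
sum-atMostOne {suc n} f {c} f≤c unique with f zero in eq
... | zero  = sum-atMostOne (f ∘ suc) (f≤c ∘ suc) (λ p q → Fin.suc-injective (unique p q))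
... | suc m = begin
  suc m + sum (f ∘ suc) ≡⟨ cong (suc m +_) (sum-zero rest) ⟩
  suc m + 0             ≡⟨ +-identityʳ _ ⟩
  suc m                 ≡⟨ eq ⟨
  f zero                ≤⟨ f≤c zero ⟩
  c                     ∎
  where
  open ≤-Reasoning
  rest : ∀ i → f (suc i) ≡ 0
  rest i with f (suc i) in eq′
  ... | zero  = refl
  ... | suc _ with () ← unique {zero} {suc i} (subst (0 <_) (sym eq) z<s) (subst (0 <_) (sym eq′) z<s)

bit : Bool → ℕ
bit b = if b then 1 else 0

bit≤1 : ∀ b → bit b ≤ 1
bit≤1 true  = ≤-refl
bit≤1 false = z≤n

infix 5 _==_
_==_ : ∀ {n} → Fin n → Fin n → Bool
i == j = does (i Fin.≟ j)

==-refl : ∀ {n} (i : Fin n) → (i == i) ≡ true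
==-refl i = dec-true (i Fin.≟ i) refl

==⇒≡ : ∀ {n} {i j : Fin n} → (i == j) ≡ true → i ≡ j
==⇒≡ {i = i} {j} eq with i Fin.≟ j
... | yes i≡j = i≡j
==⇒≡ () | no _

sum-delta : ∀ {n} (j : Fin n) (f : Fin n → ℕ) → sum (λ i → bit (j == i) * f i) ≡ f j
sum-delta {suc n} zero f = begin
  f zero + 0 + sum (λ i → bit (zero == suc i) * f (suc i))
    ≡⟨ cong₂ _+_ (+-identityʳ _) (sum-zero {n} (λ _ → refl)) ⟩
  f zero + 0 ≡⟨ +-identityʳ _ ⟩
  f zero ∎
  where open ≡-Reasoning
sum-delta (suc j) f = sum-delta j (f ∘ suc)

pos-factors : ∀ {m n} → 0 < m * n → 0 < m × 0 < n
pos-factors {suc m} {suc n} _ = z<s , z<s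
pos-factors {suc m} {zero} p = contradiction (subst (0 <_) (*-zeroʳ m) p) (λ ())

bit-pos : ∀ {b} → 0 < bit b → b ≡ true
bit-pos {true} _ = refl

-- The sum over `x` is regrouped by the value `g x`, and each fibre has at most one positive term.
-- Injectivity is asked only where `F` is positive, so that the lemma also compares counts of
-- predicates.
sum-injection : ∀ {m n} {F : Fin m → ℕ} {f : Fin n → ℕ} (g : Fin m → Fin n) →
  (∀ x → F x ≤ f (g x)) → (∀ {x y} → 0 < F x → 0 < F y → g x ≡ g y → x ≡ y) →
  sum F ≤ sum f
sum-injection {F = F} {f} g F≤fg injective = begin
  sum F                                            ≡⟨ sum-cong-≗ (λ x → sum-delta (g x) (λ _ → F x)) ⟨
  sum (λ x → sum (λ y → bit (g x == y) * F x))     ≡⟨ ∑-comm (λ x y → bit (g x == y) * F x) ⟩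
  sum (λ y → sum (λ x → bit (g x == y) * F x))     ≤⟨ sum-mono fibre ⟩
  sum f                                            ∎
  where
  open ≤-Reasoning
  bound : ∀ y x → bit (g x == y) * F x ≤ f y
  bound y x with g x Fin.≟ y
  ... | yes refl = ≤-trans (≤-reflexive (+-identityʳ _)) (F≤fg x)
  ... | no  _    = z≤n
  fibre : ∀ y → sum (λ x → bit (g x == y) * F x) ≤ f y
  fibre y = sum-atMostOne _ (bound y) λ p q →
    let p₁ , p₂ = pos-factors p; q₁ , q₂ = pos-factors q
    in injective p₂ q₂ (trans (==⇒≡ (bit-pos p₁)) (sym (==⇒≡ (bit-pos q₁))))

argmin : ∀ {k} (f : Fin (suc k) → ℕ) → ∃[ i ] (∀ j → f i ≤ f j)
argmin {zero}  f = zero , λ { zero → ≤-refl }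
argmin {suc k} f with argmin (f ∘ suc)
... | i , least with ≤-total (f zero) (f (suc i))
...   | inj₁ le = zero , λ { zero → ≤-refl ; (suc j) → ≤-trans le (least j) }
...   | inj₂ ge = suc i , λ { zero → ge ; (suc j) → least j }

average : ∀ {k} (f : Fin (suc k) → ℕ) → ∃[ i ] suc k * f i ≤ sum f
average {k} f with argmin f
... | i , least = i , ≤-trans (≤-reflexive (sym (sum-const (suc k) (f i)))) (sum-mono least)

count : ∀ {n} → (Fin n → Bool) → ℕ
count P = sum (bit ∘ P)

bit-mono : ∀ {b c} → (b ≡ true → c ≡ true) → bit b ≤ bit c
bit-mono {false}    h = z≤n
bit-mono {true} {c} h rewrite h refl = ≤-refl

count-mono : ∀ {n} {P Q : Fin n → Bool} → (∀ x → P x ≡ true → Q x ≡ true) → count P ≤ count Q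
count-mono h = sum-mono (bit-mono ∘ h)

count-injection : ∀ {m n} {P : Fin m → Bool} {Q : Fin n → Bool} (g : Fin m → Fin n) →
  (∀ x → P x ≡ true → Q (g x) ≡ true) →
  (∀ {x y} → P x ≡ true → P y ≡ true → g x ≡ g y → x ≡ y) → count P ≤ count Q
count-injection g P⇒Q injective =
  sum-injection g (bit-mono ∘ P⇒Q) (λ p q → injective (bit-pos p) (bit-pos q))

count-injection-≤ : ∀ {m n} {P : Fin m → Bool} (g : Fin m → Fin n) →
  (∀ {x y} → P x ≡ true → P y ≡ true → g x ≡ g y → x ≡ y) → count P ≤ n
count-injection-≤ {n = n} g injective =
  ≤-trans (count-injection {Q = λ _ → true} g (λ _ _ → refl) injective)
          (≤-reflexive (trans (sum-const n 1) (*-identityʳ n)))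

count≥1⇒∃ : ∀ {n} (P : Fin n → Bool) → 1 ≤ count P → ∃[ x ] P x ≡ true
count≥1⇒∃ {suc n} P h with P zero in eq
... | true  = zero , eq
... | false = let x , px = count≥1⇒∃ (P ∘ suc) h in suc x , px

count≥2⇒∃₂ : ∀ {n} (P : Fin n → Bool) → 2 ≤ count P →
  ∃[ x ] ∃[ y ] (P x ≡ true × P y ≡ true × x ≢ y)
count≥2⇒∃₂ {suc n} P h with P zero in eq
... | true  = let x , px = count≥1⇒∃ (P ∘ suc) (s≤s⁻¹ h) in zero , suc x , eq , px , λ ()
... | false = let x , y , px , py , x≢y = count≥2⇒∃₂ (P ∘ suc) h
              in suc x , suc y , px , py , x≢y ∘ Fin.suc-injective

∃₂⇒count≥2 : ∀ {n} {P : Fin n → Bool} {x y} → P x ≡ true → P y ≡ true → x ≢ y → 2 ≤ count P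
∃₂⇒count≥2 {n} {P} {x} {y} px py x≢y = count-injection {P = λ (_ : Fin 2) → true} pick
  (λ { zero _ → px ; (suc zero) _ → py })
  (λ { {zero}     {zero}     _ _ _  → refl
     ; {zero}     {suc zero} _ _ eq → contradiction eq x≢y
     ; {suc zero} {zero}     _ _ eq → contradiction (sym eq) x≢y
     ; {suc zero} {suc zero} _ _ _  → refl })
  where
  pick : Fin 2 → Fin n
  pick zero       = x
  pick (suc zero) = y

rank : ∀ {n} → (Fin n → Bool) → Fin n → ℕ
rank P zero    = 0
rank P (suc x) = bit (P zero) + rank (P ∘ suc) x

rank-< : ∀ {n} (P : Fin n → Bool) x → P x ≡ true → rank P x < count P
rank-< P zero    px rewrite px = z<s
rank-< P (suc x) px = +-monoʳ-< (bit (P zero)) (rank-< (P ∘ suc) x px)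

rank-injective : ∀ {n} (P : Fin n → Bool) {x y} → P x ≡ true → P y ≡ true →
  rank P x ≡ rank P y → x ≡ y
rank-injective P {zero}  {zero}  px py eq = refl
rank-injective P {zero}  {suc y} px py eq rewrite px with () ← eq
rank-injective P {suc x} {zero}  px py eq rewrite py with () ← eq
rank-injective P {suc x} {suc y} px py eq =
  cong suc (rank-injective (P ∘ suc) px py (+-cancelˡ-≡ (bit (P zero)) _ _ eq))

abstract
  -- A total function, so that it can serve as a colour at every vertex. The default `zero` is never
  -- reached on `P` when `P` has at most `k + 1` elements.
  label : ∀ {n} k → (Fin n → Bool) → Fin n → Fin (suc k)
  label k P x with rank P x <? suc k
  ... | yes r<k = fromℕ< r<k
  ... | no  _   = zero

  toℕ-label : ∀ {n} k (P : Fin n → Bool) → count P ≤ suc k → ∀ x → P x ≡ true →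
    toℕ (label k P x) ≡ rank P x
  toℕ-label k P P≤k x px with rank P x <? suc k
  ... | yes r<k = Fin.toℕ-fromℕ< r<k
  ... | no  r≮k = contradiction (<-≤-trans (rank-< P x px) P≤k) r≮k

  label-injective : ∀ {n} k (P : Fin n → Bool) → count P ≤ suc k → ∀ {x y} →
    P x ≡ true → P y ≡ true → label k P x ≡ label k P y → x ≡ y
  label-injective k P P≤k {x} {y} px py eq = rank-injective P px py (begin
    rank P x            ≡⟨ toℕ-label k P P≤k x px ⟨
    toℕ (label k P x)   ≡⟨ cong toℕ eq ⟩
    toℕ (label k P y)   ≡⟨ toℕ-label k P P≤k y py ⟩
    rank P y            ∎)
    where open ≡-Reasoning

-- A commutative Latin square on k + 1 symbols.

reflect : ℕ → ℕ → ℕ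
reflect k s with s ≤? k
... | yes _ = k ∸ s
... | no  _ = k + suc k ∸ s

reflect-low : ∀ {k s} → s ≤ k → reflect k s ≡ k ∸ s
reflect-low {k} {s} s≤k with s ≤? k
... | yes _   = refl
... | no  s≰k = contradiction s≤k s≰k

reflect-high : ∀ {k s} → k < s → reflect k s ≡ k + suc k ∸ s
reflect-high {k} {s} k<s with s ≤? k
... | yes s≤k = contradiction s≤k (<⇒≱ k<s)
... | no  _   = refl

m+[o∸[m+n]]≡o∸n : ∀ m n {o} → m + n ≤ o → m + (o ∸ (m + n)) ≡ o ∸ n
m+[o∸[m+n]]≡o∸n m n {o} m+n≤o = begin
  m + (o ∸ (m + n)) ≡⟨ cong (λ t → m + (o ∸ t)) (+-comm m n) ⟩
  m + (o ∸ (n + m)) ≡⟨ cong (m +_) (∸-+-assoc o n m) ⟨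
  m + (o ∸ n ∸ m)   ≡⟨ m+[n∸m]≡n (m+n≤o⇒m≤o∸n m m+n≤o) ⟩
  o ∸ n             ∎
  where open ≡-Reasoning

reflect-≤ : ∀ k s → reflect k s ≤ k
reflect-≤ k s with s ≤? k
... | yes _   = m∸n≤m k s
... | no  s≰k = begin
  k + suc k ∸ s      ≤⟨ ∸-monoʳ-≤ (k + suc k) (≰⇒> s≰k) ⟩
  k + suc k ∸ suc k  ≡⟨ m+n∸n≡m k (suc k) ⟩
  k                  ∎
  where open ≤-Reasoning

-- For sums `s` up to `2k`, `reflect k s` is `k − s` modulo `k + 1`, and `k − (x + (k − (x + y)))`
-- is `y`. If `x + y` does not exceed `k`, the outer argument is `k − y`; otherwise it is
-- `2k + 1 − y`, which lies above `k` and selects the other branch.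
reflect-involutive : ∀ {k} x y → x ≤ k → y ≤ k → reflect k (x + reflect k (x + y)) ≡ y
reflect-involutive {k} x y x≤k y≤k = case x + y ≤? k of λ where
    (yes low) → begin
      reflect k (x + reflect k (x + y))  ≡⟨ cong (λ z → reflect k (x + z)) (reflect-low low) ⟩
      reflect k (x + (k ∸ (x + y)))      ≡⟨ cong (reflect k) (m+[o∸[m+n]]≡o∸n x y low) ⟩
      reflect k (k ∸ y)                  ≡⟨ reflect-low (m∸n≤m k y) ⟩
      k ∸ (k ∸ y)                        ≡⟨ m∸[m∸n]≡n y≤k ⟩
      y                                  ∎
    (no ¬low) → begin
      reflect k (x + reflect k (x + y))          ≡⟨ cong (λ z → reflect k (x + z)) (reflect-high (≰⇒> ¬low)) ⟩
      reflect k (x + (k + suc k ∸ (x + y)))      ≡⟨ cong (reflect k) (m+[o∸[m+n]]≡o∸n x y (+-mono-≤ x≤k y≤1+k)) ⟩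
      reflect k (k + suc k ∸ y)                  ≡⟨ reflect-high above ⟩
      k + suc k ∸ (k + suc k ∸ y)                ≡⟨ m∸[m∸n]≡n (m≤n⇒m≤o+n k y≤1+k) ⟩
      y                                          ∎
  where
  open ≡-Reasoning
  y≤1+k : y ≤ suc k
  y≤1+k = m≤n⇒m≤1+n y≤k
  above : k < k + suc k ∸ y
  above = ≤-trans (≤-reflexive (sym (m+n∸m≡n k (suc k)))) (∸-monoʳ-≤ (k + suc k) y≤k)

infixl 6 _⊙_
abstract
  -- Addition modulo k + 1 followed by the reflection z ↦ k − z: commutative, and
  -- involutive in each argument, so it is at once a Latin square and its own inverse.
  _⊙_ : ∀ {k} → Fin (suc k) → Fin (suc k) → Fin (suc k)
  _⊙_ {k} x y = fromℕ< (s≤s (reflect-≤ k (toℕ x + toℕ y)))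

  toℕ-⊙ : ∀ {k} (x y : Fin (suc k)) → toℕ (x ⊙ y) ≡ reflect k (toℕ x + toℕ y)
  toℕ-⊙ x y = Fin.toℕ-fromℕ< _

  ⊙-comm : ∀ {k} (x y : Fin (suc k)) → x ⊙ y ≡ y ⊙ x
  ⊙-comm {k} x y = Fin.toℕ-injective (begin
    toℕ (x ⊙ y)                ≡⟨ toℕ-⊙ x y ⟩
    reflect k (toℕ x + toℕ y)  ≡⟨ cong (reflect k) (+-comm (toℕ x) (toℕ y)) ⟩
    reflect k (toℕ y + toℕ x)  ≡⟨ toℕ-⊙ y x ⟨
    toℕ (y ⊙ x)                ∎)
    where open ≡-Reasoning

  ⊙-involutive : ∀ {k} (x y : Fin (suc k)) → x ⊙ (x ⊙ y) ≡ y
  ⊙-involutive {k} x y = Fin.toℕ-injective (begin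
    toℕ (x ⊙ (x ⊙ y))                                ≡⟨ toℕ-⊙ x (x ⊙ y) ⟩
    reflect k (toℕ x + toℕ (x ⊙ y))                  ≡⟨ cong (λ z → reflect k (toℕ x + z)) (toℕ-⊙ x y) ⟩
    reflect k (toℕ x + reflect k (toℕ x + toℕ y))
      ≡⟨ reflect-involutive (toℕ x) (toℕ y) (Fin.toℕ≤pred[n] x) (Fin.toℕ≤pred[n] y) ⟩
    toℕ y                                            ∎)
    where open ≡-Reasoning

⊙-cancelˡ : ∀ {k} (x : Fin (suc k)) {y z} → x ⊙ y ≡ x ⊙ z → y ≡ z
⊙-cancelˡ x {y} {z} eq = trans (sym (⊙-involutive x y)) (trans (cong (x ⊙_) eq) (⊙-involutive x z))

⊙-cancelʳ : ∀ {k} (x : Fin (suc k)) {y z} → y ⊙ x ≡ z ⊙ x → y ≡ z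
⊙-cancelʳ x {y} {z} eq = ⊙-cancelˡ x (trans (⊙-comm x y) (trans eq (⊙-comm z x)))

-- Balanced partitions from shifted blocks.

module _ {k : ℕ} where
  private
    K : ℕ
    K = suc k

  -- With `i` fixed, `s ⊙ i` takes no index twice as `s` varies, so the values `a (s ⊙ i)` sum to at
  -- most `sum a`. Since `a` is 0-1 valued, its squares are linear, and summing over `s` averages
  -- the cross terms with `D i`.
  sum-shift : (a D : Fin K → ℕ) → (∀ j → a j ≤ 1) → ∀ t → sum D ≤ t →
    sum (λ s → sum (λ i → (a (s ⊙ i) + D i) * (a (s ⊙ i) + D i)))
      ≤ K * sum a + 2 * (t * sum a) + K * sum (λ i → D i * D i)
  sum-shift a D a≤1 t ΣD≤t = begin
    sum (λ s → sum (λ i → (a (s ⊙ i) + D i) * (a (s ⊙ i) + D i)))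
      ≡⟨ ∑-comm (λ s i → (a (s ⊙ i) + D i) * (a (s ⊙ i) + D i)) ⟩
    sum (λ i → sum (λ s → (a (s ⊙ i) + D i) * (a (s ⊙ i) + D i)))
      ≤⟨ sum-mono column ⟩
    sum (λ i → (sum a + D i * (2 * sum a)) + K * (D i * D i))
      ≡⟨ ∑-distrib-+ (λ i → sum a + D i * (2 * sum a)) (λ i → K * (D i * D i)) ⟩
    sum (λ i → sum a + D i * (2 * sum a)) + sum (λ i → K * (D i * D i))
      ≡⟨ cong₂ _+_ (∑-distrib-+ {K} (λ i → sum a) (λ i → D i * (2 * sum a))) (sym (*-distribˡ-sum K (λ i → D i * D i))) ⟩
    sum {K} (λ i → sum a) + sum (λ i → D i * (2 * sum a)) + K * sum (λ i → D i * D i)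
      ≡⟨ cong (_+ K * sum (λ i → D i * D i)) (cong₂ _+_ (sum-const K (sum a)) (sym (*-distribʳ-sum (2 * sum a) D))) ⟩
    K * sum a + sum D * (2 * sum a) + K * sum (λ i → D i * D i)
      ≤⟨ +-monoˡ-≤ (K * sum (λ i → D i * D i)) (+-monoʳ-≤ (K * sum a) (*-monoˡ-≤ (2 * sum a) ΣD≤t)) ⟩
    K * sum a + t * (2 * sum a) + K * sum (λ i → D i * D i)
      ≡⟨ cong (λ z → K * sum a + z + K * sum (λ i → D i * D i)) (swap t (sum a)) ⟩
    K * sum a + 2 * (t * sum a) + K * sum (λ i → D i * D i) ∎
    where
    open ≤-Reasoning
    swap : ∀ t α → t * (2 * α) ≡ 2 * (t * α)
    swap = solve-∀
    expand : ∀ x d → x ≤ 1 → (x + d) * (x + d) ≤ x + x * (2 * d) + d * d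
    expand zero          d _ = ≤-refl
    expand (suc zero)    d _ = ≤-reflexive (square d)
      where
      square : ∀ d → (1 + d) * (1 + d) ≡ 1 + 1 * (2 * d) + d * d
      square = solve-∀
    expand (suc (suc _)) d (s≤s ())
    row : ∀ i → sum (λ s → a (s ⊙ i)) ≤ sum a
    row i = sum-injection {f = a} (_⊙ i) (λ _ → ≤-refl) (λ _ _ → ⊙-cancelʳ i)
    rearrange : ∀ α d → α * (2 * d) ≡ d * (2 * α)
    rearrange = solve-∀
    column : ∀ i → sum (λ s → (a (s ⊙ i) + D i) * (a (s ⊙ i) + D i))
                   ≤ (sum a + D i * (2 * sum a)) + K * (D i * D i)
    column i = begin
      sum (λ s → (a (s ⊙ i) + D i) * (a (s ⊙ i) + D i))
        ≤⟨ sum-mono (λ s → expand (a (s ⊙ i)) (D i) (a≤1 (s ⊙ i))) ⟩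
      sum (λ s → a (s ⊙ i) + a (s ⊙ i) * (2 * D i) + D i * D i)
        ≡⟨ ∑-distrib-+ (λ s → a (s ⊙ i) + a (s ⊙ i) * (2 * D i)) (λ s → D i * D i) ⟩
      sum (λ s → a (s ⊙ i) + a (s ⊙ i) * (2 * D i)) + sum {K} (λ s → D i * D i)
        ≡⟨ cong₂ _+_ (∑-distrib-+ (λ s → a (s ⊙ i)) (λ s → a (s ⊙ i) * (2 * D i))) (sum-const K (D i * D i)) ⟩
      sum (λ s → a (s ⊙ i)) + sum (λ s → a (s ⊙ i) * (2 * D i)) + K * (D i * D i)
        ≡⟨ cong (λ z → sum (λ s → a (s ⊙ i)) + z + K * (D i * D i)) (*-distribʳ-sum (2 * D i) (λ s → a (s ⊙ i))) ⟨
      sum (λ s → a (s ⊙ i)) + sum (λ s → a (s ⊙ i)) * (2 * D i) + K * (D i * D i)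
        ≤⟨ +-monoˡ-≤ (K * (D i * D i)) (+-mono-≤ (row i) (*-monoˡ-≤ (2 * D i) (row i))) ⟩
      sum a + sum a * (2 * D i) + K * (D i * D i)
        ≡⟨ cong (λ z → sum a + z + K * (D i * D i)) (rearrange (sum a) (D i)) ⟩
      (sum a + D i * (2 * sum a)) + K * (D i * D i) ∎

  -- In the application `A b j v` counts the neighbours of `v` at index `j` of block `b`. The shift
  -- sends index `j` to part `σ b ⊙ j`, so part `i` receives index `σ b ⊙ i`.
  load : ∀ {B M} → (Fin B → Fin K → Fin M → ℕ) → (Fin B → Fin K) → Fin M → Fin K → ℕ
  load A σ v i = sum (λ b → A b (σ b ⊙ i) v)

  total : ∀ {B M} → (Fin B → Fin K → Fin M → ℕ) → Fin M → ℕ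
  total A v = sum (λ b → sum (λ j → A b j v))

  sum-load : ∀ {B M} (A : Fin B → Fin K → Fin M → ℕ) σ v → sum (load A σ v) ≤ total A v
  sum-load A σ v = begin
    sum (λ i → sum (λ b → A b (σ b ⊙ i) v))  ≡⟨ ∑-comm (λ i b → A b (σ b ⊙ i) v) ⟩
    sum (λ b → sum (λ i → A b (σ b ⊙ i) v))
      ≤⟨ sum-mono (λ b → sum-injection {f = λ j → A b j v} (σ b ⊙_) (λ _ → ≤-refl) (λ _ _ → ⊙-cancelˡ (σ b))) ⟩
    total A v                                ∎
    where open ≤-Reasoning

  abstract
    -- The average of the left-hand side over all shifts σ obeys this bound, because
    -- two entries of one block never share a part; the shifts are chosen one block at a time.
    balancing-shifts : ∀ {B M} (A : Fin B → Fin K → Fin M → ℕ) → (∀ b j v → A b j v ≤ 1) →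
      ∃[ σ ] K * sum (λ v → sum (λ i → load A σ v i * load A σ v i))
               ≤ sum (λ v → total A v * total A v + K * total A v)
    balancing-shifts {zero} {M} A A≤1 = (λ ()) , (begin
      K * sum {M} (λ v → sum {K} (λ i → 0))
        ≡⟨ cong (K *_) (sum-zero {M} (λ _ → sum-zero {K} (λ _ → refl))) ⟩
      K * 0  ≡⟨ *-zeroʳ K ⟩
      0      ≤⟨ z≤n ⟩
      sum {M} (λ v → 0 + K * 0) ∎)
      where open ≤-Reasoning
    balancing-shifts {suc B} {M} A A≤1
      with balancing-shifts (A ∘ suc) (A≤1 ∘ suc)
    ... | σ , bound = shifts , (begin
      K * cost s₀
        ≤⟨ proj₂ best ⟩
      sum cost
        ≡⟨ ∑-comm (λ s v → sum (λ i → (a v (s ⊙ i) + D v i) * (a v (s ⊙ i) + D v i))) ⟩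
      sum (λ v → sum (λ s → sum (λ i → (a v (s ⊙ i) + D v i) * (a v (s ⊙ i) + D v i))))
        ≤⟨ sum-mono (λ v → sum-shift (a v) (D v) (λ j → A≤1 zero j v) (t v) (sum-load (A ∘ suc) σ v)) ⟩
      sum (λ v → K * α v + 2 * (t v * α v) + K * sum (λ i → D v i * D v i))
        ≡⟨ ∑-distrib-+ (λ v → K * α v + 2 * (t v * α v)) (λ v → K * sum (λ i → D v i * D v i)) ⟩
      sum (λ v → K * α v + 2 * (t v * α v)) + sum (λ v → K * sum (λ i → D v i * D v i))
        ≡⟨ cong (sum (λ v → K * α v + 2 * (t v * α v)) +_) (*-distribˡ-sum K (λ v → sum (λ i → D v i * D v i))) ⟨
      sum (λ v → K * α v + 2 * (t v * α v)) + K * sum (λ v → sum (λ i → D v i * D v i))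
        ≤⟨ +-monoʳ-≤ (sum (λ v → K * α v + 2 * (t v * α v))) bound ⟩
      sum (λ v → K * α v + 2 * (t v * α v)) + sum (λ v → t v * t v + K * t v)
        ≡⟨ ∑-distrib-+ (λ v → K * α v + 2 * (t v * α v)) (λ v → t v * t v + K * t v) ⟨
      sum (λ v → K * α v + 2 * (t v * α v) + (t v * t v + K * t v))
        ≤⟨ sum-mono (λ v → complete-square (α v) (t v)) ⟩
      sum (λ v → total A v * total A v + K * total A v) ∎)
      where
      open ≤-Reasoning
      a : Fin M → Fin K → ℕ
      a v j = A zero j v
      α t : Fin M → ℕ
      α v = sum (a v)
      t = total (A ∘ suc)
      D : Fin M → Fin K → ℕ
      D = load (A ∘ suc) σ
      cost : Fin K → ℕ
      cost s = sum (λ v → sum (λ i → (a v (s ⊙ i) + D v i) * (a v (s ⊙ i) + D v i)))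
      -- The blocks already placed contribute the fixed load `D`; the new block gets a shift of at
      -- most average cost.
      best : ∃[ s ] K * cost s ≤ sum cost
      best = average cost
      s₀ : Fin K
      s₀ = proj₁ best
      shifts : Fin (suc B) → Fin K
      shifts zero    = s₀
      shifts (suc b) = σ b
      -- The leftover `α * α` is slack: pairs inside the new block never share a part and cost only
      -- the diagonal term `K * α`.
      identity : ∀ K α t → (α + t) * (α + t) + K * (α + t) ≡ K * α + 2 * (t * α) + (t * t + K * t) + α * α
      identity = solve-∀
      complete-square : ∀ α t → K * α + 2 * (t * α) + (t * t + K * t) ≤ (α + t) * (α + t) + K * (α + t)
      complete-square α t = ≤-trans (m≤m+n _ (α * α)) (≤-reflexive (sym (identity K α t)))

≤ᵇ-sound : ∀ m n → (m ≤ᵇ n) ≡ true → m ≤ n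
≤ᵇ-sound m n eq = ≤ᵇ⇒≤ m n (subst T (sym eq) tt)

≤ᵇ-refute : ∀ m n → (m ≤ᵇ n) ≡ false → n < m
≤ᵇ-refute m n eq = ≰⇒> (λ m≤n → subst T eq (≤⇒≤ᵇ m≤n))

bit-∧ : ∀ b c → bit (b ∧ c) ≡ bit b * bit c
bit-∧ true  c = sym (+-identityʳ _)
bit-∧ false c = refl

∧-true : ∀ {b c} → b ≡ true → c ≡ true → b ∧ c ≡ true
∧-true refl refl = refl

-- Each block is permuted by its own shift, so within a block the part determines the index.
-- Positions need to be distinct only among the `s` marked by a common `w v`; this makes every entry
-- `A b j v` at most 1.
balanced-partition : ∀ {k B M N} (blk : Fin N → Fin B) (idx : Fin N → Fin (suc k)) (w : Fin M → Fin N → Bool) →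
  (∀ v {s s′} → w v s ≡ true → w v s′ ≡ true → blk s ≡ blk s′ → idx s ≡ idx s′ → s ≡ s′) →
  Σ[ part ∈ (Fin N → Fin (suc k)) ]
    ((∀ {s s′} → blk s ≡ blk s′ → part s ≡ part s′ → idx s ≡ idx s′)
    × suc k * sum (λ v → sum (λ i → count (λ s → (part s == i) ∧ w v s) * count (λ s → (part s == i) ∧ w v s)))
      ≤ sum (λ v → count (w v) * count (w v) + suc k * count (w v)))
balanced-partition {k} {B} {M} {N} blk idx w injective =
  part , (λ {s} {s′} b eq → ⊙-cancelˡ (σ (blk s)) (trans eq (cong (λ β → σ β ⊙ idx s′) (sym b)))) , (begin
    suc k * sum (λ v → sum (λ i → d v i * d v i))
      ≤⟨ *-monoʳ-≤ (suc k) (sum-mono (λ v → sum-mono (λ i → *-mono-≤ (d≤load v i) (d≤load v i)))) ⟩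
    suc k * sum (λ v → sum (λ i → load A σ v i * load A σ v i))
      ≤⟨ bound ⟩
    sum (λ v → total A v * total A v + suc k * total A v)
      ≡⟨ sum-cong-≗ (λ v → cong (λ t → t * t + suc k * t) (total≡ v)) ⟩
    sum (λ v → count (w v) * count (w v) + suc k * count (w v)) ∎)
  where
  open ≤-Reasoning
  entry : Fin B → Fin (suc k) → Fin M → Fin N → ℕ
  entry b j v s = bit (blk s == b) * (bit (idx s == j) * bit (w v s))
  A : Fin B → Fin (suc k) → Fin M → ℕ
  A b j v = sum (entry b j v)
  A≤1 : ∀ b j v → A b j v ≤ 1
  A≤1 b j v = sum-atMostOne (entry b j v)
    (λ s → *-mono-≤ (bit≤1 (blk s == b)) (*-mono-≤ (bit≤1 (idx s == j)) (bit≤1 (w v s))))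
    λ p q → let p₁ , p′ = pos-factors p; p₂ , p₃ = pos-factors p′
                q₁ , q′ = pos-factors q; q₂ , q₃ = pos-factors q′
            in injective v (bit-pos p₃) (bit-pos q₃)
                 (trans (==⇒≡ (bit-pos p₁)) (sym (==⇒≡ (bit-pos q₁))))
                 (trans (==⇒≡ (bit-pos p₂)) (sym (==⇒≡ (bit-pos q₂))))
  balanced = balancing-shifts A A≤1
  σ : Fin B → Fin (suc k)
  σ = proj₁ balanced
  bound = proj₂ balanced
  part : Fin N → Fin (suc k)
  part s = σ (blk s) ⊙ idx s
  d : Fin M → Fin (suc k) → ℕ
  d v i = count (λ s → (part s == i) ∧ w v s)
  total≡ : ∀ v → total A v ≡ count (w v)
  total≡ v = begin-equality
    sum (λ b → sum (λ j → sum (entry b j v)))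
      ≡⟨ sum-cong-≗ (λ b → ∑-comm (λ j s → entry b j v s)) ⟩
    sum (λ b → sum (λ s → sum (λ j → entry b j v s)))
      ≡⟨ ∑-comm (λ b s → sum (λ j → entry b j v s)) ⟩
    sum (λ s → sum (λ b → sum (λ j → entry b j v s)))
      ≡⟨ sum-cong-≗ (λ s → sum-cong-≗ (λ b →
           trans (sym (*-distribˡ-sum (bit (blk s == b)) (λ j → bit (idx s == j) * bit (w v s))))
                 (cong (bit (blk s == b) *_) (sum-delta (idx s) (λ _ → bit (w v s)))))) ⟩
    sum (λ s → sum (λ b → bit (blk s == b) * bit (w v s)))
      ≡⟨ sum-cong-≗ (λ s → sum-delta (blk s) (λ _ → bit (w v s))) ⟩
    count (w v) ∎
  -- A vertex of part `i` has index `σ (blk s) ⊙ i`, because `⊙` is its own inverse.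
  in-block : ∀ v i s → bit ((part s == i) ∧ w v s) ≤ entry (blk s) (σ (blk s) ⊙ i) v s
  in-block v i s with part s Fin.≟ i
  ... | no  _    = z≤n
  ... | yes refl = ≤-reflexive (sym (begin-equality
    bit (blk s == blk s) * (bit (idx s == σ (blk s) ⊙ part s) * bit (w v s))
      ≡⟨ cong₂ (λ x y → bit x * (bit y * bit (w v s))) (==-refl (blk s))
           (trans (cong (idx s ==_) (⊙-involutive (σ (blk s)) (idx s))) (==-refl (idx s))) ⟩
    1 * (1 * bit (w v s))
      ≡⟨ trans (*-identityˡ _) (*-identityˡ _) ⟩
    bit (w v s) ∎))
  d≤load : ∀ v i → d v i ≤ load A σ v i
  d≤load v i = begin
    sum (λ s → bit ((part s == i) ∧ w v s))
      ≤⟨ sum-mono (λ s → ≤-trans (in-block v i s) (term≤sum (λ b → entry b (σ b ⊙ i) v s) (blk s))) ⟩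
    sum (λ s → sum (λ b → entry b (σ b ⊙ i) v s))
      ≡⟨ ∑-comm (λ s b → entry b (σ b ⊙ i) v s) ⟩
    load A σ v i ∎

-- Chebyshev's inequality for crowded parts.

2mn≤m²+n² : ∀ m n → 2 * (m * n) ≤ m * m + n * n
2mn≤m²+n² m n with ≤-total m n
... | inj₁ m≤n = subst (λ n → 2 * (m * n) ≤ m * m + n * n) (m+[n∸m]≡n m≤n)
                   (≤-trans (m≤m+n _ ((n ∸ m) * (n ∸ m))) (≤-reflexive (sym (identity m (n ∸ m)))))
  where
  identity : ∀ m e → m * m + (m + e) * (m + e) ≡ 2 * (m * (m + e)) + e * e
  identity = solve-∀
... | inj₂ n≤m = subst (λ m → 2 * (m * n) ≤ m * m + n * n) (m+[n∸m]≡n n≤m)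
                   (≤-trans (m≤m+n _ ((m ∸ n) * (m ∸ n))) (≤-reflexive (sym (identity n (m ∸ n)))))
  where
  identity : ∀ n e → (n + e) * (n + e) + n * n ≡ 2 * ((n + e) * n) + e * e
  identity = solve-∀

-- A part with d i ≥ Δ exceeds the mean load t / K at least fourfold, so it contributes
-- a multiple of d i · Δ to the variance K Σ (d i)² − t².
heavy-parts : ∀ {k} (d : Fin (suc k) → ℕ) Δ → 4 * sum d ≤ suc k * Δ →
  2 * (sum d * sum d) + suc k * Δ * sum (λ i → bit (Δ ≤ᵇ d i) * d i)
    ≤ 2 * (suc k * sum (λ i → d i * d i))
heavy-parts {k} d Δ light = *-cancelˡ-≤ K (+-cancelʳ-≤ (K * (2 * (t * t))) _ _ (begin
  K * (2 * (t * t) + K * Δ * sum h) + K * (2 * (t * t))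
    ≡⟨ collect K t Δ (sum h) ⟩
  4 * K * t * t + K * K * Δ * sum h
    ≡⟨ cong₂ _+_ (*-distribˡ-sum (4 * K * t) d) (*-distribˡ-sum (K * K * Δ) h) ⟩
  sum (λ i → 4 * K * t * d i) + sum (λ i → K * K * Δ * h i)
    ≡⟨ ∑-distrib-+ (λ i → 4 * K * t * d i) (λ i → K * K * Δ * h i) ⟨
  sum (λ i → 4 * K * t * d i + K * K * Δ * h i)
    ≤⟨ sum-mono each ⟩
  sum (λ i → 2 * K * K * (d i * d i) + 2 * (t * t))
    ≡⟨ ∑-distrib-+ (λ i → 2 * K * K * (d i * d i)) (λ _ → 2 * (t * t)) ⟩
  sum (λ i → 2 * K * K * (d i * d i)) + sum {K} (λ _ → 2 * (t * t))
    ≡⟨ cong₂ _+_ (sym (*-distribˡ-sum (2 * K * K) (λ i → d i * d i))) (sum-const K (2 * (t * t))) ⟩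
  2 * K * K * sum (λ i → d i * d i) + K * (2 * (t * t))
    ≡⟨ cong (_+ K * (2 * (t * t))) (factor K (sum (λ i → d i * d i))) ⟩
  K * (2 * (K * sum (λ i → d i * d i))) + K * (2 * (t * t)) ∎))
  where
  open ≤-Reasoning
  K t : ℕ
  K = suc k
  t = sum d
  h : Fin K → ℕ
  h i = bit (Δ ≤ᵇ d i) * d i
  collect : ∀ K t Δ h → K * (2 * (t * t) + K * Δ * h) + K * (2 * (t * t)) ≡ 4 * K * t * t + K * K * Δ * h
  collect = solve-∀
  factor : ∀ K q → 2 * K * K * q ≡ K * (2 * (K * q))
  factor = solve-∀
  amgm : ∀ K t x → 4 * K * t * x ≡ 2 * (2 * (K * x * t))
  amgm = solve-∀
  amgm′ : ∀ K t x → 2 * (K * x * (K * x) + t * t) ≡ 2 * K * K * (x * x) + 2 * (t * t)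
  amgm′ = solve-∀
  heavy₁ : ∀ K t x → 4 * K * t * x ≡ 4 * t * (K * x)
  heavy₁ = solve-∀
  heavy₂ : ∀ K Δ x → K * K * Δ * (1 * x) ≡ K * Δ * (K * x)
  heavy₂ = solve-∀
  heavy₃ : ∀ K x → K * x * (K * x) + K * x * (K * x) ≡ 2 * K * K * (x * x)
  heavy₃ = solve-∀
  -- In an uncrowded part this is `2mn≤m²+n²` for `K * d i` and `t`. In a crowded part
  -- `4 * t ≤ K * Δ ≤ K * d i`, so one copy of the square of `K * d i` pays for the first term and
  -- the other copy for the second.
  each : ∀ i → 4 * K * t * d i + K * K * Δ * h i ≤ 2 * K * K * (d i * d i) + 2 * (t * t)
  each i with Δ ≤ᵇ d i in eq
  ... | false = begin
    4 * K * t * d i + K * K * Δ * 0   ≡⟨ cong (4 * K * t * d i +_) (*-zeroʳ (K * K * Δ)) ⟩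
    4 * K * t * d i + 0               ≡⟨ +-identityʳ _ ⟩
    4 * K * t * d i                   ≡⟨ amgm K t (d i) ⟩
    2 * (2 * (K * d i * t))           ≤⟨ *-monoʳ-≤ 2 (2mn≤m²+n² (K * d i) t) ⟩
    2 * (K * d i * (K * d i) + t * t) ≡⟨ amgm′ K t (d i) ⟩
    2 * K * K * (d i * d i) + 2 * (t * t) ∎
  ... | true = begin
    4 * K * t * d i + K * K * Δ * (1 * d i)    ≡⟨ cong₂ _+_ (heavy₁ K t (d i)) (heavy₂ K Δ (d i)) ⟩
    4 * t * (K * d i) + K * Δ * (K * d i)      ≤⟨ +-mono-≤ (*-monoˡ-≤ (K * d i) (≤-trans light KΔ≤))
                                                           (*-monoˡ-≤ (K * d i) KΔ≤) ⟩
    K * d i * (K * d i) + K * d i * (K * d i)  ≡⟨ heavy₃ K (d i) ⟩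
    2 * K * K * (d i * d i)                    ≤⟨ m≤m+n _ _ ⟩
    2 * K * K * (d i * d i) + 2 * (t * t)      ∎
    where
    KΔ≤ : K * Δ ≤ K * d i
    KΔ≤ = *-monoʳ-≤ K (≤ᵇ-sound Δ (d i) eq)

-- Summing `heavy-parts` over `v` bounds twice the sum of squares from below, and
-- `balanced-partition` bounds it from above. The terms `2 * (t v * t v)` cancel, and so does a
-- factor `K`.
partition-few-crowded : ∀ {k B M N} (blk : Fin N → Fin B) (idx : Fin N → Fin (suc k)) (w : Fin M → Fin N → Bool) →
  (∀ v {s s′} → w v s ≡ true → w v s′ ≡ true → blk s ≡ blk s′ → idx s ≡ idx s′ → s ≡ s′) →
  ∀ Δ → (∀ v → 4 * count (w v) ≤ suc k * Δ) →
  Σ[ part ∈ (Fin N → Fin (suc k)) ]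
    ((∀ {s s′} → blk s ≡ blk s′ → part s ≡ part s′ → idx s ≡ idx s′)
    × Δ * sum (λ v → count (λ s → w v s ∧ (Δ ≤ᵇ count (λ s′ → (part s′ == part s) ∧ w v s′))))
      ≤ 2 * sum (λ v → count (w v)))
partition-few-crowded {k} {M = M} {N} blk idx w injective Δ light = part , proj₁ (proj₂ balanced) ,
  *-cancelˡ-≤ K (+-cancelˡ-≤ (2 * sum (λ v → t v * t v)) (K * (Δ * sum crowded)) (K * (2 * sum t)) (begin
    2 * sum (λ v → t v * t v) + K * (Δ * sum crowded)
      ≡⟨ cong₂ _+_ (*-distribˡ-sum 2 (λ v → t v * t v))
           (trans (sym (*-assoc K Δ (sum crowded))) (*-distribˡ-sum (K * Δ) crowded)) ⟩
    sum (λ v → 2 * (t v * t v)) + sum (λ v → K * Δ * crowded v)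
      ≡⟨ ∑-distrib-+ (λ v → 2 * (t v * t v)) (λ v → K * Δ * crowded v) ⟨
    sum (λ v → 2 * (t v * t v) + K * Δ * crowded v)
      ≤⟨ sum-mono each ⟩
    sum (λ v → 2 * (K * sum (λ i → d v i * d v i)))
      ≡⟨ *-distribˡ-sum 2 (λ v → K * sum (λ i → d v i * d v i)) ⟨
    2 * sum (λ v → K * sum (λ i → d v i * d v i))
      ≡⟨ cong (2 *_) (*-distribˡ-sum K (λ v → sum (λ i → d v i * d v i))) ⟨
    2 * (K * sum (λ v → sum (λ i → d v i * d v i)))
      ≤⟨ *-monoʳ-≤ 2 (proj₂ (proj₂ balanced)) ⟩
    2 * sum (λ v → t v * t v + K * t v)
      ≡⟨ cong (2 *_) (trans (∑-distrib-+ (λ v → t v * t v) (λ v → K * t v))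
                            (cong (sum (λ v → t v * t v) +_) (sym (*-distribˡ-sum K t)))) ⟩
    2 * (sum (λ v → t v * t v) + K * sum t)
      ≡⟨ distribute K (sum (λ v → t v * t v)) (sum t) ⟩
    2 * sum (λ v → t v * t v) + K * (2 * sum t) ∎))
  where
  open ≤-Reasoning
  K : ℕ
  K = suc k
  balanced = balanced-partition blk idx w injective
  part : Fin N → Fin K
  part = proj₁ balanced
  t : Fin M → ℕ
  t v = count (w v)
  d : Fin M → Fin K → ℕ
  d v i = count (λ s → (part s == i) ∧ w v s)
  crowded : Fin M → ℕ
  crowded v = count (λ s → w v s ∧ (Δ ≤ᵇ d v (part s)))
  distribute : ∀ K a b → 2 * (a + K * b) ≡ 2 * a + K * (2 * b)
  distribute = solve-∀
  -- Double counting: every neighbour lies in exactly one part, so a weight on parts becomes a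
  -- weight on neighbours.
  by-parts : ∀ v (f : Fin K → ℕ) → sum (λ i → f i * d v i) ≡ sum (λ s → f (part s) * bit (w v s))
  by-parts v f = begin-equality
    sum (λ i → f i * d v i)
      ≡⟨ sum-cong-≗ (λ i → *-distribˡ-sum (f i) (λ s → bit ((part s == i) ∧ w v s))) ⟩
    sum (λ i → sum (λ s → f i * bit ((part s == i) ∧ w v s)))
      ≡⟨ ∑-comm (λ i s → f i * bit ((part s == i) ∧ w v s)) ⟩
    sum (λ s → sum (λ i → f i * bit ((part s == i) ∧ w v s)))
      ≡⟨ sum-cong-≗ (λ s → sum-cong-≗ (λ i →
           trans (cong (f i *_) (bit-∧ (part s == i) (w v s)))
                 (rearrange (f i) (bit (part s == i)) (bit (w v s))))) ⟩
    sum (λ s → sum (λ i → bit (part s == i) * (f i * bit (w v s))))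
      ≡⟨ sum-cong-≗ (λ s → sum-delta (part s) (λ i → f i * bit (w v s))) ⟩
    sum (λ s → f (part s) * bit (w v s)) ∎
    where
    rearrange : ∀ x y z → x * (y * z) ≡ y * (x * z)
    rearrange = solve-∀
  Σd≡t : ∀ v → sum (d v) ≡ t v
  Σd≡t v = begin-equality
    sum (d v)                              ≡⟨ sum-cong-≗ (λ i → *-identityˡ (d v i)) ⟨
    sum (λ i → 1 * d v i)                  ≡⟨ by-parts v (λ _ → 1) ⟩
    sum (λ s → 1 * bit (w v s))            ≡⟨ sum-cong-≗ (λ s → *-identityˡ (bit (w v s))) ⟩
    t v                                    ∎
  crowded≡ : ∀ v → crowded v ≡ sum (λ i → bit (Δ ≤ᵇ d v i) * d v i)
  crowded≡ v = begin-equality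
    crowded v
      ≡⟨ sum-cong-≗ (λ s → trans (bit-∧ (w v s) (Δ ≤ᵇ d v (part s))) (*-comm (bit (w v s)) (bit (Δ ≤ᵇ d v (part s))))) ⟩
    sum (λ s → bit (Δ ≤ᵇ d v (part s)) * bit (w v s))
      ≡⟨ by-parts v (λ i → bit (Δ ≤ᵇ d v i)) ⟨
    sum (λ i → bit (Δ ≤ᵇ d v i) * d v i) ∎
  each : ∀ v → 2 * (t v * t v) + K * Δ * crowded v ≤ 2 * (K * sum (λ i → d v i * d v i))
  each v = begin
    2 * (t v * t v) + K * Δ * crowded v
      ≡⟨ cong₂ (λ x y → 2 * (x * x) + K * Δ * y) (sym (Σd≡t v)) (crowded≡ v) ⟩
    2 * (sum (d v) * sum (d v)) + K * Δ * sum (λ i → bit (Δ ≤ᵇ d v i) * d v i)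
      ≤⟨ heavy-parts (d v) Δ (≤-trans (≤-reflexive (cong (4 *_) (Σd≡t v))) (light v)) ⟩
    2 * (K * sum (λ i → d v i * d v i)) ∎

-- Greedy edge colouring with small colour degrees.

joins : ∀ {N} → Fin N × Fin N → Fin N → Fin N → Bool
joins (a , b) v u = (v == a) ∧ (u == b) ∨ (v == b) ∧ (u == a)

joins⇒≡ : ∀ {N} (e : Fin N × Fin N) {v u} → joins e v u ≡ true → (v , u) ≡ e ⊎ (u , v) ≡ e
joins⇒≡ (a , b) {v} {u} eq with (v == a) ∧ (u == b) in ab | (v == b) ∧ (u == a) in ba
... | true  | _    = inj₁ (cong₂ _,_ (==⇒≡ (∧-conicalˡ _ _ ab)) (==⇒≡ (∧-conicalʳ _ _ ab)))
... | false | true = inj₂ (cong₂ _,_ (==⇒≡ (∧-conicalʳ _ _ ba)) (==⇒≡ (∧-conicalˡ _ _ ba)))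
joins⇒≡ _ () | false | false

joins-refl : ∀ {N} (v u : Fin N) → joins (v , u) v u ≡ true
joins-refl v u rewrite ==-refl v | ==-refl u = refl

joins-sym : ∀ {N} (e : Fin N × Fin N) v u → joins e v u ≡ joins e u v
joins-sym (a , b) v u with v == a | u == b | v == b | u == a
... | true  | true  | true  | true  = refl
... | true  | true  | true  | false = refl
... | true  | true  | false | true  = refl
... | true  | true  | false | false = refl
... | true  | false | true  | true  = refl
... | true  | false | true  | false = refl
... | true  | false | false | true  = refl
... | true  | false | false | false = refl
... | false | true  | true  | true  = refl
... | false | true  | true  | false = refl
... | false | true  | false | true  = refl
... | false | true  | false | false = refl
... | false | false | true  | true  = refl
... | false | false | true  | false = refl
... | false | false | false | true  = refl
... | false | false | false | false = refl

joined : ∀ {N} → List (Fin N × Fin N) → Fin N → Fin N → Bool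
joined []       v u = false
joined (e ∷ es) v u = joined es v u ∨ joins e v u

∈⇒joined : ∀ {N} {es : List (Fin N × Fin N)} {v u} → (v , u) ∈ es → joined es v u ≡ true
∈⇒joined {es = _ ∷ es} {v} {u} (here refl) rewrite joins-refl v u with joined es v u
... | true  = refl
... | false = refl
∈⇒joined (there v,u∈es) rewrite ∈⇒joined v,u∈es = refl

sum-colour-degrees : ∀ {K N} (L : Fin N → Bool) (c : Fin N → Fin K) →
  sum (λ i → count (λ u → L u ∧ (c u == i))) ≡ count L
sum-colour-degrees L c = begin
  sum (λ i → sum (λ u → bit (L u ∧ (c u == i))))         ≡⟨ ∑-comm (λ i u → bit (L u ∧ (c u == i))) ⟩
  sum (λ u → sum (λ i → bit (L u ∧ (c u == i))))
    ≡⟨ sum-cong-≗ (λ u → sum-cong-≗ (λ i → trans (bit-∧ (L u) (c u == i)) (*-comm (bit (L u)) (bit (c u == i))))) ⟩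
  sum (λ u → sum (λ i → bit (c u == i) * bit (L u)))     ≡⟨ sum-cong-≗ (λ u → sum-delta (c u) (λ _ → bit (L u))) ⟩
  count L                                                ∎
  where open ≡-Reasoning

colourDegree : ∀ {K N} → (Fin N → Fin N → Bool) → (Fin N → Fin N → Fin K) → Fin N → Fin K → ℕ
colourDegree L χ v i = count (λ u → L v u ∧ (χ v u == i))

ColourableBelow : ∀ {N} → ℕ → ℕ → (Fin N → Fin N → Bool) → Set
ColourableBelow {N} K Δ L = Σ[ χ ∈ (Fin N → Fin N → Fin K) ]
  ((∀ v u → χ v u ≡ χ u v) × (∀ v i → colourDegree L χ v i < Δ))

colourable-mono : ∀ {N K Δ} {L L′ : Fin N → Fin N → Bool} →
  (∀ v u → L v u ≡ true → L′ v u ≡ true) → ColourableBelow K Δ L′ → ColourableBelow K Δ L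
colourable-mono {L = L} {L′} L⊆L′ (χ , χ-sym , bound) = χ , χ-sym , λ v i →
  ≤-<-trans (count-mono {P = λ u → L v u ∧ (χ v u == i)} {Q = λ u → L′ v u ∧ (χ v u == i)}
              (λ u p → ∧-true (L⊆L′ v u (∧-conicalˡ _ _ p)) (∧-conicalʳ _ _ p)))
            (bound v i)

-- The hypotheses give `2 * (x + y) < Δ`. Hence `2 * suc x < 2 + Δ`, and `2 ≤ Δ` absorbs the 2.
suc<-from-average : ∀ K Δ x y p q → 2 ≤ Δ → K * (x + y) ≤ p + q →
  4 * p < K * Δ → 4 * q < K * Δ → suc x < Δ
suc<-from-average K Δ x y p q 2≤Δ avg 4p< 4q< = *-cancelˡ-< 2 (suc x) Δ (begin-strict
  2 * suc x      ≡⟨ *-suc 2 x ⟩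
  2 + 2 * x      <⟨ +-monoʳ-< 2 2x<Δ ⟩
  2 + Δ          ≤⟨ +-monoˡ-≤ Δ 2≤Δ ⟩
  Δ + Δ          ≡⟨ cong (Δ +_) (+-identityʳ Δ) ⟨
  2 * Δ          ∎)
  where
  open ≤-Reasoning
  quadruple : ∀ K x y → 2 * K * (2 * x) + 4 * (K * y) ≡ 4 * (K * (x + y))
  quadruple = solve-∀
  double : ∀ K Δ → K * Δ + K * Δ ≡ 2 * K * Δ
  double = solve-∀
  2x<Δ : 2 * x < Δ
  2x<Δ = *-cancelˡ-< (2 * K) (2 * x) Δ (begin-strict
    2 * K * (2 * x)                ≤⟨ m≤m+n _ _ ⟩
    2 * K * (2 * x) + 4 * (K * y)  ≡⟨ quadruple K x y ⟩
    4 * (K * (x + y))              ≤⟨ *-monoʳ-≤ 4 avg ⟩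
    4 * (p + q)                    ≡⟨ *-distribˡ-+ 4 p q ⟩
    4 * p + 4 * q                  <⟨ +-mono-< 4p< 4q< ⟩
    K * Δ + K * Δ                  ≡⟨ double K Δ ⟩
    2 * K * Δ                      ∎)

-- `L` holds the edges coloured so far. The colour least used at the two ends of `e` together is
-- used there at most the average number of times, which leaves room for one more edge at each end.
colour-edge : ∀ {N k Δ} (adj L : Fin N → Fin N → Bool) → 2 ≤ Δ →
  (∀ v → 4 * count (adj v) < suc k * Δ) →
  (∀ v u → L v u ≡ true → adj v u ≡ true) → ∀ e → proj₁ e ≢ proj₂ e →
  ColourableBelow (suc k) Δ L → ColourableBelow (suc k) Δ (λ v u → L v u ∨ joins e v u)
colour-edge {N} {k} {Δ} adj L 2≤Δ light L⊆adj e@(a , b) a≢b (χ , χ-sym , bound) =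
  χ′ , χ′-sym , bound′
  where
  open ≤-Reasoning
  d : Fin N → Fin (suc k) → ℕ
  d = colourDegree L χ
  best : ∃[ i ] suc k * (d a i + d b i) ≤ sum (λ i → d a i + d b i)
  best = average (λ i → d a i + d b i)
  i₀ : Fin (suc k)
  i₀ = proj₁ best
  average≤ : suc k * (d a i₀ + d b i₀) ≤ count (adj a) + count (adj b)
  average≤ = begin
    suc k * (d a i₀ + d b i₀)                ≤⟨ proj₂ best ⟩
    sum (λ i → d a i + d b i)                ≡⟨ ∑-distrib-+ (d a) (d b) ⟩
    sum (d a) + sum (d b)                    ≡⟨ cong₂ _+_ (sum-colour-degrees (L a) (χ a)) (sum-colour-degrees (L b) (χ b)) ⟩
    count (L a) + count (L b)                ≤⟨ +-mono-≤ (count-mono (L⊆adj a)) (count-mono (L⊆adj b)) ⟩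
    count (adj a) + count (adj b)            ∎
  room-a : suc (d a i₀) < Δ
  room-a = suc<-from-average (suc k) Δ (d a i₀) (d b i₀) (count (adj a)) (count (adj b)) 2≤Δ average≤ (light a) (light b)
  room-b : suc (d b i₀) < Δ
  room-b = suc<-from-average (suc k) Δ (d b i₀) (d a i₀) (count (adj b)) (count (adj a)) 2≤Δ
    (subst₂ (λ x y → suc k * x ≤ y) (+-comm (d a i₀) (d b i₀)) (+-comm (count (adj a)) (count (adj b))) average≤)
    (light b) (light a)
  χ′ : Fin N → Fin N → Fin (suc k)
  -- If `e` already lies in `L` it is recoloured and charged to `extra`; the greedy run meets every
  -- edge in both orientations.
  χ′ v u = if joins e v u then i₀ else χ v u
  χ′-sym : ∀ v u → χ′ v u ≡ χ′ u v
  χ′-sym v u rewrite joins-sym e v u | χ-sym v u = refl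
  extra : Fin N → Fin (suc k) → ℕ
  extra v i = count (λ u → joins e v u ∧ (i₀ == i))
  pointwise : ∀ v i u → bit ((L v u ∨ joins e v u) ∧ (χ′ v u == i))
                        ≤ bit (L v u ∧ (χ v u == i)) + bit (joins e v u ∧ (i₀ == i))
  pointwise v i u with joins e v u | L v u
  ... | true  | true  = m≤n+m _ _
  ... | true  | false = ≤-refl
  ... | false | true  = m≤m+n _ _
  ... | false | false = z≤n
  grows : ∀ v i → colourDegree (λ v u → L v u ∨ joins e v u) χ′ v i ≤ d v i + extra v i
  grows v i = ≤-trans (sum-mono (pointwise v i))
    (≤-reflexive (∑-distrib-+ (λ u → bit (L v u ∧ (χ v u == i))) (λ u → bit (joins e v u ∧ (i₀ == i)))))
  partner-unique : ∀ {v u u′} → joins e v u ≡ true → joins e v u′ ≡ true → u ≡ u′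
  partner-unique {v} {u} {u′} p q with joins⇒≡ e {v} {u} p | joins⇒≡ e {v} {u′} q
  ... | inj₁ refl | inj₁ refl = refl
  ... | inj₁ refl | inj₂ refl = contradiction refl a≢b
  ... | inj₂ refl | inj₁ refl = contradiction refl a≢b
  ... | inj₂ refl | inj₂ refl = refl
  extra≤1 : ∀ v i → extra v i ≤ 1
  extra≤1 v i = sum-atMostOne (λ u → bit (joins e v u ∧ (i₀ == i))) (λ u → bit≤1 (joins e v u ∧ (i₀ == i)))
    (λ {u} {u′} p q → partner-unique {v} {u} {u′} (∧-conicalˡ _ _ (bit-pos p)) (∧-conicalˡ _ _ (bit-pos q)))
  bound′ : ∀ v i → colourDegree (λ v u → L v u ∨ joins e v u) χ′ v i < Δ
  bound′ v i = ≤-<-trans (grows v i) (cases (count≥1? (extra v i) refl))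
    where
    count≥1? : ∀ x → extra v i ≡ x → extra v i ≡ 0 ⊎ 1 ≤ extra v i
    count≥1? zero    eq = inj₁ eq
    count≥1? (suc x) eq = inj₂ (≤-trans (s≤s z≤n) (≤-reflexive (sym eq)))
    room : ∀ {v i} → suc (d v i) < Δ → d v i + extra v i < Δ
    room {v} {i} h = ≤-<-trans (≤-trans (+-monoʳ-≤ (d v i) (extra≤1 v i)) (≤-reflexive (+-comm (d v i) 1))) h
    cases : extra v i ≡ 0 ⊎ 1 ≤ extra v i → d v i + extra v i < Δ
    cases (inj₁ none) = subst (_< Δ) (sym (trans (cong (d v i +_) none) (+-identityʳ (d v i)))) (bound v i)
    cases (inj₂ some) with count≥1⇒∃ (λ u → joins e v u ∧ (i₀ == i)) some
    ... | u , p with joins⇒≡ e {v} {u} (∧-conicalˡ _ _ p) | ==⇒≡ {i = i₀} {i} (∧-conicalʳ (joins e v u) _ p)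
    ...   | inj₁ refl | refl = room room-a
    ...   | inj₂ refl | refl = room room-b

abstract
  -- All ordered pairs are run through and those not adjacent are skipped. Room is measured against
  -- the full degrees in `adj`, so the order of insertion is immaterial.
  greedy-colouring : ∀ {N k Δ} (adj : Fin N → Fin N → Bool) → 2 ≤ Δ →
    (∀ v u → adj v u ≡ adj u v) → (∀ v → adj v v ≡ false) →
    (∀ v → 4 * count (adj v) < suc k * Δ) → ColourableBelow (suc k) Δ adj
  greedy-colouring {N} {k} {Δ} adj 2≤Δ adj-sym adj-irrefl light =
    colourable-mono (λ v u vu → ∧-true vu (∈⇒joined (∈-cartesianProduct⁺ (∈-allFin v) (∈-allFin u))))
      (colour-all (cartesianProduct (allFin N) (allFin N)))
    where
    colour-all : ∀ es → ColourableBelow (suc k) Δ (λ v u → adj v u ∧ joined es v u)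
    colour-all [] = (λ _ _ → zero) , (λ _ _ → refl) , λ v i →
      subst (_< Δ) (sym (sum-zero {N} (λ u → cong bit (none (adj v u) _)))) (≤-trans (s≤s z≤n) 2≤Δ)
      where
      none : ∀ x y → (x ∧ false) ∧ y ≡ false
      none true  y = refl
      none false y = refl
    colour-all (e@(a , b) ∷ es) with adj a b in ab
    ... | true = colourable-mono widen
      (colour-edge adj (λ v u → adj v u ∧ joined es v u) 2≤Δ light (λ v u → ∧-conicalˡ _ _) e
         (λ { refl → case trans (sym ab) (adj-irrefl a) of λ () }) (colour-all es))
      where
      widen : ∀ v u → adj v u ∧ (joined es v u ∨ joins e v u) ≡ true →
                      (adj v u ∧ joined es v u) ∨ joins e v u ≡ true
      widen v u with adj v u
      ... | true  = λ p → p
      ... | false = λ ()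
    ... | false = colourable-mono shrink (colour-all es)
      where
      non-edge : ∀ {v u} → joins e v u ≡ true → adj v u ≡ false
      non-edge {v} {u} p with joins⇒≡ e {v} {u} p
      ... | inj₁ refl = ab
      ... | inj₂ refl = trans (adj-sym b a) ab
      shrink : ∀ v u → adj v u ∧ (joined es v u ∨ joins e v u) ≡ true → adj v u ∧ joined es v u ≡ true
      shrink v u p with joined es v u | joins e v u in j
      ... | true  | _     = ∧-true (∧-conicalˡ _ _ p) refl
      ... | false | true  = case trans (sym (∧-conicalˡ _ _ p)) (non-edge {v} {u} j) of λ ()
      ... | false | false = p

-- Degrees, edge counts and connected bipartite graphs.

∣∣≡count : ∀ {n} (p : Subset n) → ∣ p ∣ ≡ count (lookup p)
∣∣≡count []            = refl
∣∣≡count (inside  ∷ p) = cong suc (∣∣≡count p)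
∣∣≡count (outside ∷ p) = ∣∣≡count p

length-filter-tabulate : ∀ {A : Set} {P : Pred A 0ℓ} (P? : Decidable P) {n} (f : Fin n → A) →
  length (filter P? (tabulate f)) ≡ count (λ i → does (P? (f i)))
length-filter-tabulate P? {zero}  f = refl
length-filter-tabulate P? {suc n} f with does (P? (f zero))
... | true  = cong suc (length-filter-tabulate P? (f ∘ suc))
... | false = length-filter-tabulate P? (f ∘ suc)

length-filter-product : ∀ {A B : Set} {P : Pred (A × B) 0ℓ} (P? : Decidable P) {m n} (f : Fin m → A) (g : Fin n → B) →
  length (filter P? (cartesianProduct (tabulate f) (tabulate g)))
    ≡ sum (λ i → count (λ j → does (P? (f i , g j))))
length-filter-product P? {zero}  f g = refl
length-filter-product P? {suc m} f g = begin
  length (filter P? (row ++ rest))                ≡⟨ cong length (filter-++ P? row rest) ⟩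
  length (filter P? row ++ filter P? rest)        ≡⟨ length-++ (filter P? row) ⟩
  length (filter P? row) + length (filter P? rest)
    ≡⟨ cong₂ _+_ (trans (cong (length ∘ filter P?) (map-tabulate g (f zero ,_)))
                        (length-filter-tabulate P? (λ j → f zero , g j)))
                 (length-filter-product P? (f ∘ suc) g) ⟩
  sum (λ i → count (λ j → does (P? (f i , g j)))) ∎
  where
  open ≡-Reasoning
  row  = map (f zero ,_) (tabulate g)
  rest = cartesianProduct (tabulate (f ∘ suc)) (tabulate g)

module _ {n : ℕ} (G : Graph n) where
  open Graph G hiding (sym)

  adjacent : Fin n → Fin n → Bool
  adjacent v u = does (v ~? u)

  adjacent⇒~ : ∀ {v u} → adjacent v u ≡ true → v ~ u
  adjacent⇒~ {v} {u} eq with v ~? u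
  ... | yes v~u = v~u
  adjacent⇒~ () | no _

  ~⇒adjacent : ∀ {v u} → v ~ u → adjacent v u ≡ true
  ~⇒adjacent {v} {u} = dec-true (v ~? u)

  adjacent-sym : ∀ v u → adjacent v u ≡ adjacent u v
  adjacent-sym v u with v ~? u
  ... | yes v~u = sym (~⇒adjacent (Graph.sym G v~u))
  ... | no ¬v~u = sym (dec-false (u ~? v) (¬v~u ∘ Graph.sym G))

  adjacent-irrefl : ∀ v → adjacent v v ≡ false
  adjacent-irrefl v = dec-false (v ~? v) (irrefl refl)

  degree≡count : ∀ v → degree v ≡ count (adjacent v)
  degree≡count v = trans (∣∣≡count (neighbours v))
    (sum-cong-≗ (λ u → cong bit (lookup∘tabulate (adjacent v) u)))

  -- Ordered adjacencies are split by the order of their ends. The increasing ones are those that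
  -- `edges` lists, and exchanging the sums gives the decreasing ones the same total.
  handshake : sum (λ v → count (adjacent v)) ≤ 2 * edgeCount
  handshake = begin
    sum (λ v → sum (λ u → bit (adjacent v u)))
      ≤⟨ sum-mono (λ v → sum-mono (λ u → oriented v u)) ⟩
    sum (λ v → sum (λ u → forward v u + forward u v))
      ≡⟨ sum-cong-≗ (λ v → ∑-distrib-+ (forward v) (λ u → forward u v)) ⟩
    sum (λ v → sum (forward v) + sum (λ u → forward u v))
      ≡⟨ ∑-distrib-+ (λ v → sum (forward v)) (λ v → sum (λ u → forward u v)) ⟩
    sum (λ v → sum (forward v)) + sum (λ v → sum (λ u → forward u v))
      ≡⟨ cong (sum (λ v → sum (forward v)) +_) (∑-comm (λ v u → forward u v)) ⟩
    sum (λ v → sum (forward v)) + sum (λ v → sum (forward v))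
      ≡⟨ cong₂ _+_ edges≡ (trans edges≡ (sym (+-identityʳ edgeCount))) ⟩
    2 * edgeCount ∎
    where
    open ≤-Reasoning
    forward : Fin n → Fin n → ℕ
    forward v u = bit (does (v Fin.<? u) ∧ adjacent v u)
    edges≡ : sum (λ v → sum (forward v)) ≡ edgeCount
    edges≡ = sym (length-filter-product (λ e → (proj₁ e Fin.<? proj₂ e) ×-dec (proj₁ e ~? proj₂ e)) {n} {n} (λ i → i) (λ i → i))
    oriented : ∀ v u → bit (adjacent v u) ≤ forward v u + forward u v
    oriented v u with Fin.<-cmp v u
    ... | tri< v<u _ _ rewrite dec-true (v Fin.<? u) v<u = m≤m+n _ _
    ... | tri≈ _ refl _ rewrite adjacent-irrefl v = z≤n
    ... | tri> _ _ u<v rewrite dec-true (u Fin.<? v) u<v | adjacent-sym v u = m≤n+m _ _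

  two-neighbours : ∀ {v u w} → v ~ u → v ~ w → u ≢ w → 2 ≤ degree v
  two-neighbours {v} {u} {w} v~u v~w u≢w = ≤-trans
    (∃₂⇒count≥2 (~⇒adjacent v~u) (~⇒adjacent v~w) u≢w)
    (≤-reflexive (sym (degree≡count v)))

  maxDegreeIn-attained : ∀ S → 1 ≤ maxDegreeIn S → ∃[ v ] (v ∈ˢ S × degree v ≡ maxDegreeIn S)
  maxDegreeIn-attained S 1≤max with argmax-sel (λ d → d) 0 (map degree (filter (_∈ˢ? S) (allFin n)))
  ... | inj₁ max≡0 = contradiction (≤-trans 1≤max (≤-reflexive max≡0)) (λ ())
  ... | inj₂ max∈ with ∈-map⁻ degree max∈
  ...   | v , v∈ , eq = v , proj₂ (∈-filter⁻ (_∈ˢ? S) {xs = allFin n} v∈) , sym eq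

  degree≤maxDegreeIn : ∀ {S v} → v ∈ˢ S → degree v ≤ maxDegreeIn S
  degree≤maxDegreeIn {S} {v} v∈S =
    All-lookup (xs≤max 0 (map degree (filter (_∈ˢ? S) (allFin n))))
      (∈-map⁺ degree (∈-filter⁺ (_∈ˢ? S) (∈-allFin v) v∈S))

  along-walk : (Q : Fin n → Set) → (∀ {u v} → u ~ v → Q u → Q v) → ∀ {u v} → Walk _~_ u v → Q u → Q v
  along-walk Q step ε          q = q
  along-walk Q step (e ◅ walk) q = along-walk Q step walk (step e q)

  module _ (side : Fin n → Bool) (cross : ∀ {u v} → u ~ v → side v ≡ not (side u)) where

    -- The walk begins with `y`, `a`, `w`, and `a` is on the opposite side. If `w` differs from `y`,
    -- then `a` has two neighbours; otherwise these two steps are dropped and the search continues.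
    branching-vertex : ∀ {y y′} → side y ≡ false → side y′ ≡ false → y ≢ y′ → Walk _~_ y y′ →
      ∃[ h ] (side h ≡ true × 2 ≤ degree h)
    branching-vertex _ _ y≢y ε = contradiction refl y≢y
    branching-vertex sy sy′ _ (y~a ◅ ε) =
      case trans (sym sy′) (trans (cross y~a) (cong not sy)) of λ ()
    branching-vertex {y} sy sy′ y≢y′ (_◅_ {j = a} y~a (_◅_ {j = w} a~w walk)) with w Fin.≟ y
    ... | yes refl = branching-vertex sy sy′ y≢y′ walk
    ... | no  w≢y  = a , trans (cross y~a) (cong not sy) , two-neighbours (Graph.sym G y~a) a~w (w≢y ∘ sym)

module _ {m : ℕ} (H : Graph (2 + m)) (connected : Graph.Connected H)
         (side : Fin (2 + m) → Bool) (cross : ∀ {u v} → Graph._~_ H u v → side v ≡ not (side u)) where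
  open Graph H using (_~_; irrefl)

  -- Transposing `x` with `zero` puts the centre where `completeBipartite 1` expects it. Every edge
  -- contains `x` because sides alternate, and connectivity joins every other vertex to `x`.
  star-if-unique : ∀ x → side x ≡ true → (∀ {v} → side v ≡ true → v ≡ x) → IsStar H
  star-if-unique x sx unique = suc m , record { bijection = τ ; adjacency = λ u v → mk⇔ (to u v) (from u v) }
    where
    τ = Permutation.transpose x zero
    τ⟨_⟩ : Fin (2 + m) → Fin (2 + m)
    τ⟨_⟩ = Inverse.to τ
    τx≡0 : τ⟨ x ⟩ ≡ zero
    τx≡0 rewrite ==-refl x = refl
    centre : ∀ {u} → toℕ τ⟨ u ⟩ < 1 → u ≡ x
    centre {u} lt = trans (sym (Permutation.inverseˡ τ)) (trans (cong (Inverse.from τ) (trans (Fin.toℕ-injective (n<1⇒n≡0 lt)) (sym τx≡0))) (Permutation.inverseˡ τ))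
    at-centre : ∀ {u} → u ≡ x → toℕ τ⟨ u ⟩ < 1
    at-centre refl = subst (λ z → toℕ z < 1) (sym τx≡0) z<s
    off-centre : ∀ {u} → u ≢ x → 1 ≤ toℕ τ⟨ u ⟩
    off-centre u≢x = ≮⇒≥ (u≢x ∘ centre)
    not-centre : ∀ {u} → 1 ≤ toℕ τ⟨ u ⟩ → u ≢ x
    not-centre le u≡x = <⇒≱ (at-centre u≡x) le
    -- The first edge of a walk from `w` to `x` crosses to the side whose only vertex is `x`.
    leaf~x : ∀ {w} → w ≢ x → w ~ x
    leaf~x {w} w≢x with connected w x
    ... | ε = contradiction refl w≢x
    ... | w~y ◅ _ = subst (w ~_) (unique (trans (cross w~y) (cong not (¬-not (w≢x ∘ unique))))) w~y
    to : ∀ u v → u ~ v → (toℕ τ⟨ u ⟩ < 1 × 1 ≤ toℕ τ⟨ v ⟩) ⊎ (1 ≤ toℕ τ⟨ u ⟩ × toℕ τ⟨ v ⟩ < 1)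
    to u v u~v = case u Fin.≟ x of λ where
      (yes u≡x) → inj₁ (at-centre u≡x , off-centre (λ v≡x → irrefl (trans u≡x (sym v≡x)) u~v))
      (no  u≢x) → inj₂ (off-centre u≢x ,
                        at-centre (unique (trans (cross u~v) (cong not (¬-not (u≢x ∘ unique))))))
    from : ∀ u v → (toℕ τ⟨ u ⟩ < 1 × 1 ≤ toℕ τ⟨ v ⟩) ⊎ (1 ≤ toℕ τ⟨ u ⟩ × toℕ τ⟨ v ⟩ < 1) → u ~ v
    from u v (inj₁ (p , q)) = subst (_~ v) (sym (centre p)) (Graph.sym H (leaf~x (not-centre q)))
    from u v (inj₂ (p , q)) = subst (u ~_) (sym (centre q)) (leaf~x (not-centre p))

  side-nonempty : ∃[ x ] side x ≡ true
  -- A walk between two different vertices has a first edge, which reaches the wanted side if `zero`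
  -- is not on it.
  side-nonempty with side zero in s₀ | connected zero (suc zero)
  ... | true  | _         = zero , s₀
  ... | false | 0~y ◅ _ = _ , trans (cross 0~y) (cong not s₀)

  both-sides≥2 : ¬ IsStar H → 2 ≤ count side
  both-sides≥2 ¬star = ≮⇒≥ λ small →
    let x , sx = side-nonempty
    in ¬star (star-if-unique x sx λ {v} sv → case v Fin.≟ x of λ where
         (yes v≡x) → v≡x
         (no  v≢x) → contradiction small (≤⇒≯ (∃₂⇒count≥2 sv sx v≢x)))

-- Construction of parts, classes and local colourings.

markov : ∀ {n} c (f : Fin n → ℕ) → count (λ x → c ≤ᵇ f x) * c ≤ sum f
markov c f = ≤-trans (≤-reflexive (*-distribʳ-sum c (λ x → bit (c ≤ᵇ f x)))) (sum-mono each)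
  where
  each : ∀ x → bit (c ≤ᵇ f x) * c ≤ f x
  each x with c ≤ᵇ f x in eq
  ... | true  = ≤-trans (≤-reflexive (+-identityʳ c)) (≤ᵇ-sound c (f x) eq)
  ... | false = z≤n

abstract
  -- The elements of `P` are numbered, and the number is split into a block and an index within the
  -- block.
  grid-placement : ∀ {N} m k (P : Fin N → Bool) → count P ≤ suc m * suc k →
    Σ[ place ∈ (Fin N → Fin (suc m) × Fin (suc k)) ]
      (∀ {x y} → P x ≡ true → P y ≡ true →
       proj₁ (place x) ≡ proj₁ (place y) → proj₂ (place x) ≡ proj₂ (place y) → x ≡ y)
  grid-placement {N} m k P P≤ = remQuot (suc k) ∘ pos , λ {x} {y} px py e₁ e₂ →
    label-injective (k + m * suc k) P P≤ px py
      (trans (sym (Fin.combine-remQuot {suc m} (suc k) (pos x)))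
        (trans (cong₂ combine e₁ e₂) (Fin.combine-remQuot {suc m} (suc k) (pos y))))
    where
    pos : Fin N → Fin (suc m * suc k)
    pos = label (k + m * suc k) P

module _ {N} (G : Graph N) (big : Fin N → Bool) where
  smallToBig : Fin N → Fin N → Bool
  smallToBig v s = not (big v) ∧ (big s ∧ adjacent G v s)

  smallAdj : Fin N → Fin N → Bool
  smallAdj v u = adjacent G v u ∧ (not (big v) ∧ not (big u))

  module _ {K} (part : Fin N → Fin K) where
    partDegree : Fin N → Fin K → ℕ
    partDegree v i = count (λ s → (part s == i) ∧ smallToBig v s)

    crowdedNeighbour : ℕ → Fin N → Fin N → Bool
    crowdedNeighbour Δ v s = smallToBig v s ∧ (Δ ≤ᵇ partDegree v (part s))

-- Class `zero` is reserved for unstarred vertices, which leaves one class fewer for the starred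
-- ones.
mark : ∀ {k} → Bool → Fin k → Fin (suc k)
mark b i = if b then suc i else zero

-- The interface between construction and colouring: each palette has `k + 1` colours, and `m` is to
-- be smaller than the given side of `H`. The labels are defined at all vertices, so the fibre
-- bounds are restricted to big or starred ones.
record Scheme {N} (G : Graph N) (k m Δ : ℕ) : Set where
  field
    big star : Fin N → Bool
    part cls : Fin N → Fin (suc k)
    χ slot   : Fin N → Fin N → Fin (suc k)
    part-fibre : ∀ i → count (λ s → big s ∧ (part s == i)) ≤ m
    cls-fibre  : ∀ i → count (λ v → star v ∧ (cls v == i)) ≤ m
    cls≡0⇔unstarred : ∀ {v} → (star v ≡ false → cls v ≡ zero) × (star v ≡ true → cls v ≢ zero)
    χ-sym   : ∀ v u → χ v u ≡ χ u v
    χ-bound : ∀ v i → colourDegree (smallAdj G big) χ v i < Δ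
    slot-injective : ∀ {v s t} → star v ≡ false →
      crowdedNeighbour G big part Δ v s ≡ true → crowdedNeighbour G big part Δ v t ≡ true →
      slot v s ≡ slot v t → s ≡ t

-- H will have a side with m + 1 = 2 + m₂ vertices and maximum degree Δ, and each of the
-- three palettes has K = 2 + k₂ colours.
module Construction {N} (G : Graph N) (k₂ m₂ Δ : ℕ) (2≤Δ : 2 ≤ Δ)
  (sparse : 72 * Graph.edgeCount G < (2 + k₂) * (2 + k₂) * ((2 + m₂) * Δ)) where
  open ≤-Reasoning

  private
    k′ K m E : ℕ
    k′ = suc k₂
    K = suc k′
    m = suc m₂
    E = Graph.edgeCount G
    adj : Fin N → Fin N → Bool
    adj = adjacent G

  sparse⇒< : ∀ c x → c * (x * (K * Δ)) ≤ 72 * E → c * x < K * suc m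
  sparse⇒< c x h = *-cancelʳ-< (K * Δ) (c * x) (K * suc m) (begin-strict
    c * x * (K * Δ)       ≡⟨ *-assoc c x (K * Δ) ⟩
    c * (x * (K * Δ))     ≤⟨ h ⟩
    72 * E                <⟨ sparse ⟩
    K * K * (suc m * Δ)   ≡⟨ regroup K (suc m) Δ ⟩
    K * suc m * (K * Δ)   ∎)
    where
    regroup : ∀ K a Δ → K * K * (a * Δ) ≡ K * a * (K * Δ)
    regroup = solve-∀

  big : Fin N → Bool
  big v = K * Δ ≤ᵇ 4 * count (adj v)

  -- Markov's inequality and `handshake` give `count big * (K * Δ) ≤ 8 * E`, and 72 is 9 times 8. So
  -- `9 * count big < K * suc m`, while `suc m` is at most `2 * m`.
  count-big : count big ≤ m * K
  count-big = ≮⇒≥ λ mK<S → <-irrefl refl (begin-strict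
    K * suc m               ≤⟨ *-monoʳ-≤ K (s≤s (m≤m+n m m₂)) ⟩
    K * (suc (m + m₂))      ≡⟨ cong (K *_) (+-suc m m₂) ⟨
    K * (m + m)             ≡⟨ double K m ⟩
    2 * (m * K)             ≤⟨ *-monoˡ-≤ (m * K) {2} {9} (s≤s (s≤s z≤n)) ⟩
    9 * (m * K)             ≤⟨ *-monoʳ-≤ 9 (<⇒≤ mK<S) ⟩
    9 * count big           <⟨ sparse⇒< 9 (count big) bound ⟩
    K * suc m               ∎)
    where
    double : ∀ K m → K * (m + m) ≡ 2 * (m * K)
    double = solve-∀
    nine : ∀ E → 9 * (4 * (2 * E)) ≡ 72 * E
    nine = solve-∀
    bound : 9 * (count big * (K * Δ)) ≤ 72 * E
    bound = begin
      9 * (count big * (K * Δ))            ≤⟨ *-monoʳ-≤ 9 (markov (K * Δ) (λ v → 4 * count (adj v))) ⟩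
      9 * sum (λ v → 4 * count (adj v))    ≡⟨ cong (9 *_) (*-distribˡ-sum 4 (λ v → count (adj v))) ⟨
      9 * (4 * sum (λ v → count (adj v)))  ≤⟨ *-monoʳ-≤ 9 (*-monoʳ-≤ 4 (handshake G)) ⟩
      9 * (4 * (2 * E))                    ≡⟨ nine E ⟩
      72 * E                               ∎

  bigGrid : Σ[ place ∈ (Fin N → Fin m × Fin K) ]
    (∀ {s t} → big s ≡ true → big t ≡ true →
     proj₁ (place s) ≡ proj₁ (place t) → proj₂ (place s) ≡ proj₂ (place t) → s ≡ t)
  bigGrid = grid-placement m₂ k′ big count-big

  place : Fin N → Fin m × Fin K
  place = proj₁ bigGrid

  w : Fin N → Fin N → Bool
  w = smallToBig G big

  w⇒big : ∀ {v s} → w v s ≡ true → big s ≡ true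
  w⇒big {v} p = ∧-conicalˡ _ _ (∧-conicalʳ (not (big v)) _ p)

  w⇒adj : ∀ v s → w v s ≡ true → adj v s ≡ true
  w⇒adj v s p = ∧-conicalʳ (big s) _ (∧-conicalʳ (not (big v)) _ p)

  w-light : ∀ v → 4 * count (w v) ≤ K * Δ
  w-light v = case big v Bool≟ true of λ where
      (yes bv) → ≤-trans (≤-reflexive (cong (4 *_) (sum-zero {N} λ s → cong (λ b → bit (not b ∧ (big s ∧ adj v s))) bv))) z≤n
      (no ¬bv) → ≤-trans (*-monoʳ-≤ 4 (count-mono (w⇒adj v))) (<⇒≤ (≤ᵇ-refute (K * Δ) _ (¬-not ¬bv)))

  partition : Σ[ part ∈ (Fin N → Fin K) ]
    ((∀ {s t} → proj₁ (place s) ≡ proj₁ (place t) → part s ≡ part t → proj₂ (place s) ≡ proj₂ (place t))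
    × Δ * sum (λ v → count (λ s → w v s ∧ (Δ ≤ᵇ count (λ t → (part t == part s) ∧ w v t))))
      ≤ 2 * sum (λ v → count (w v)))
  partition = partition-few-crowded (proj₁ ∘ place) (proj₂ ∘ place) w
    (λ v {s} {t} p q → proj₂ bigGrid (w⇒big {v} {s} p) (w⇒big {v} {t} q)) Δ w-light

  part : Fin N → Fin K
  part = proj₁ partition

  -- Big vertices of one part lie in different blocks, and there are `m` blocks.
  part-fibre : ∀ i → count (λ s → big s ∧ (part s == i)) ≤ m
  part-fibre i = count-injection-≤ (proj₁ ∘ place) λ {s} {t} p q eq →
    proj₂ bigGrid (∧-conicalˡ _ _ p) (∧-conicalˡ _ _ q) eq
      (proj₁ (proj₂ partition) eq
        (trans (==⇒≡ (∧-conicalʳ (big s) _ p)) (sym (==⇒≡ (∧-conicalʳ (big t) _ q)))))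

  crowded : Fin N → Fin N → Bool
  crowded = crowdedNeighbour G big part Δ

  -- Starred means more than `K` crowded neighbours; `pred` brings this to the threshold form of
  -- `markov`.
  star : Fin N → Bool
  star v = K ≤ᵇ pred (count (crowded v))

  crowded-few : ∀ {v} → star v ≡ false → count (crowded v) ≤ K
  crowded-few {v} eq = ≤-trans (m≤n+m∸n (count (crowded v)) 1) (≤ᵇ-refute K _ eq)

  -- By `partition` and `handshake`, `Δ` times the total number of crowded neighbours is at most
  -- `4 * E`, so Markov's inequality gives `18 * count star < K * suc m`. Both `K ≤ 2 * k′` and
  -- `suc m ≤ 2 * m` hold, so the right side is at most `4 * (m * k′)`.
  count-star : count star ≤ m * k′
  count-star = ≮⇒≥ λ mk<S → <-irrefl refl (begin-strict
    K * suc m               ≤⟨ *-mono-≤ (s≤s (m≤m+n k′ k₂)) (s≤s (m≤m+n m m₂)) ⟩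
    suc (k′ + k₂) * suc (m + m₂)  ≡⟨ cong₂ _*_ (sym (+-suc k′ k₂)) (sym (+-suc m m₂)) ⟩
    (k′ + k′) * (m + m)     ≡⟨ double k′ m ⟩
    4 * (m * k′)            ≤⟨ *-monoˡ-≤ (m * k′) {4} {18} (s≤s (s≤s (s≤s (s≤s z≤n)))) ⟩
    18 * (m * k′)           ≤⟨ *-monoʳ-≤ 18 (<⇒≤ mk<S) ⟩
    18 * count star         <⟨ sparse⇒< 18 (count star) bound ⟩
    K * suc m               ∎)
    where
    double : ∀ k m → (k + k) * (m + m) ≡ 4 * (m * k)
    double = solve-∀
    eighteen : ∀ E → 18 * (2 * (2 * E)) ≡ 72 * E
    eighteen = solve-∀
    move : ∀ x K Δ → x * (K * Δ) ≡ Δ * (x * K)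
    move = solve-∀
    bound : 18 * (count star * (K * Δ)) ≤ 72 * E
    bound = begin
      18 * (count star * (K * Δ))
        ≡⟨ cong (18 *_) (move (count star) K Δ) ⟩
      18 * (Δ * (count star * K))
        ≤⟨ *-monoʳ-≤ 18 (*-monoʳ-≤ Δ (markov K (λ v → pred (count (crowded v))))) ⟩
      18 * (Δ * sum (λ v → pred (count (crowded v))))
        ≤⟨ *-monoʳ-≤ 18 (*-monoʳ-≤ Δ (sum-mono (λ v → pred[n]≤n {count (crowded v)}))) ⟩
      18 * (Δ * sum (λ v → count (crowded v)))
        ≤⟨ *-monoʳ-≤ 18 (proj₂ (proj₂ partition)) ⟩
      18 * (2 * sum (λ v → count (w v)))
        ≤⟨ *-monoʳ-≤ 18 (*-monoʳ-≤ 2 (≤-trans (sum-mono (λ v → count-mono (w⇒adj v))) (handshake G))) ⟩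
      18 * (2 * (2 * E))
        ≡⟨ eighteen E ⟩
      72 * E ∎

  starGrid : Σ[ place ∈ (Fin N → Fin m × Fin k′) ]
    (∀ {s t} → star s ≡ true → star t ≡ true →
     proj₁ (place s) ≡ proj₁ (place t) → proj₂ (place s) ≡ proj₂ (place t) → s ≡ t)
  starGrid = grid-placement m₂ k₂ star count-star

  starPlace : Fin N → Fin m × Fin k′
  starPlace = proj₁ starGrid

  cls : Fin N → Fin K
  cls v = mark (star v) (proj₂ (starPlace v))

  cls-unstarred : ∀ {v} → star v ≡ false → cls v ≡ zero
  cls-unstarred {v} = cong (λ b → mark b (proj₂ (starPlace v)))

  cls-starred : ∀ {v} → star v ≡ true → cls v ≡ suc (proj₂ (starPlace v))
  cls-starred {v} = cong (λ b → mark b (proj₂ (starPlace v)))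

  cls-fibre : ∀ i → count (λ v → star v ∧ (cls v == i)) ≤ m
  cls-fibre i = count-injection-≤ (proj₁ ∘ starPlace) λ {u} {v} p q eq →
    proj₂ starGrid (∧-conicalˡ _ _ p) (∧-conicalˡ _ _ q) eq (Fin.suc-injective
      (trans (sym (cls-starred {u} (∧-conicalˡ _ _ p)))
        (trans (trans (==⇒≡ (∧-conicalʳ (star u) _ p)) (sym (==⇒≡ (∧-conicalʳ (star v) _ q))))
               (cls-starred {v} (∧-conicalˡ _ _ q)))))

  small-colouring : ColourableBelow K Δ (smallAdj G big)
  small-colouring = greedy-colouring (smallAdj G big) 2≤Δ
    (λ v u → cong₂ _∧_ (adjacent-sym G v u) (∧-comm (not (big v)) (not (big u))))
    (λ v → cong (_∧ (not (big v) ∧ not (big v))) (adjacent-irrefl G v))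
    light
    where
    light : ∀ v → 4 * count (smallAdj G big v) < K * Δ
    light v = case big v Bool≟ true of λ where
      (yes bv) → ≤-<-trans (≤-reflexive (cong (4 *_) (sum-zero {N} (λ u →
          cong bit (trans (cong (λ b → adj v u ∧ (not b ∧ not (big u))) bv) (∧-zeroʳ (adj v u)))))))
        (≤-trans (≤-trans (s≤s z≤n) 2≤Δ) (m≤m+n Δ (k′ * Δ)))
      (no ¬bv) → ≤-<-trans (*-monoʳ-≤ 4 (count-mono {P = smallAdj G big v} {Q = adj v} (λ u → ∧-conicalˡ _ _)))
                   (≤ᵇ-refute (K * Δ) _ (¬-not ¬bv))

  scheme : Scheme G k′ m Δ
  scheme = record
    { big = big ; star = star ; part = part ; cls = cls
    ; χ = proj₁ small-colouring ; slot = λ v → label k′ (crowded v)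
    ; part-fibre = part-fibre ; cls-fibre = cls-fibre
    ; cls≡0⇔unstarred = λ {v} → cls-unstarred , λ st cls≡0 →
        case trans (sym (cls-starred {v} st)) cls≡0 of λ ()
    ; χ-sym = proj₁ (proj₂ small-colouring) ; χ-bound = proj₂ (proj₂ small-colouring)
    ; slot-injective = λ {v} unstarred → label-injective k′ (crowded v) (crowded-few unstarred)
    }

-- The edge colouring and its case analysis.

module Colouring {N} {G : Graph N} {k m Δ : ℕ} (S : Scheme G k m Δ) where
  open Scheme S

  -- The first argument is the big end. Starred vertices are kept out of palette 2 because `slot` is
  -- injective only at unstarred ones.
  crossing : Fin N → Fin N → Fin 3 × Fin (suc k)
  crossing s v =
    if star v ∨ not (Δ ≤ᵇ partDegree G big part v (part s))
    then (suc zero , part s ⊙ cls v)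
    else (suc (suc zero) , slot v s)

  -- The sizes of the two ends are separate arguments, so that symmetry and `view` follow by
  -- matching on them.
  colFor : Bool → Bool → Fin N → Fin N → Fin 3 × Fin (suc k)
  colFor true  true  u v = zero , part u ⊙ part v
  colFor true  false u v = crossing u v
  colFor false true  u v = crossing v u
  colFor false false u v = zero , χ u v

  col : Fin N → Fin N → Fin 3 × Fin (suc k)
  col u v = colFor (big u) (big v) u v

  colFor-sym : ∀ b c u v → colFor b c u v ≡ colFor c b v u
  colFor-sym true  true  u v = cong (zero ,_) (⊙-comm (part u) (part v))
  colFor-sym true  false u v = refl
  colFor-sym false true  u v = refl
  colFor-sym false false u v = cong (zero ,_) (χ-sym u v)

  col-sym : ∀ u v → col u v ≡ col v u
  col-sym u v = colFor-sym (big u) (big v) u v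

  -- The constructor `uncrowded` also covers starred `v`, whose part degrees are not controlled;
  -- hence the implication.
  data Crossing (s v : Fin N) : Fin 3 × Fin (suc k) → Set where
    uncrowded : (star v ≡ false → partDegree G big part v (part s) < Δ) → Crossing s v (suc zero , part s ⊙ cls v)
    crowded   : star v ≡ false → (Δ ≤ᵇ partDegree G big part v (part s)) ≡ true →
                Crossing s v (suc (suc zero) , slot v s)

  -- Indexing by the colour lets a match at a known palette discard the impossible kinds of edges.
  data View (u v : Fin N) : Fin 3 × Fin (suc k) → Set where
    both-big   : big u ≡ true  → big v ≡ true  → View u v (zero , part u ⊙ part v)
    both-small : big u ≡ false → big v ≡ false → View u v (zero , χ u v)
    down       : ∀ {pc} → big u ≡ true  → big v ≡ false → Crossing u v pc → View u v pc
    up         : ∀ {pc} → big u ≡ false → big v ≡ true  → Crossing v u pc → View u v pc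

  crossing-view : ∀ s v → Crossing s v (crossing s v)
  crossing-view s v with star v in st | Δ ≤ᵇ partDegree G big part v (part s) in cr
  ... | true  | _     = uncrowded (λ st′ → case trans (sym st) st′ of λ ())
  ... | false | true  = crowded st cr
  ... | false | false = uncrowded (λ _ → ≤ᵇ-refute Δ _ cr)

  view : ∀ u v → View u v (col u v)
  view u v = viewFor (big u) (big v) refl refl
    where
    viewFor : ∀ b c → big u ≡ b → big v ≡ c → View u v (colFor b c u v)
    viewFor true  true  bu bv = both-big bu bv
    viewFor true  false bu bv = down bu bv (crossing-view u v)
    viewFor false true  bu bv = up bu bv (crossing-view v u)
    viewFor false false bu bv = both-small bu bv

  palette₀ : ∀ {u v c} → View u v (zero , c) →
    (big u ≡ true × big v ≡ true × part u ⊙ part v ≡ c) ⊎ (big u ≡ false × big v ≡ false × χ u v ≡ c)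
  palette₀ (both-big bu bv)   = inj₁ (bu , bv , refl)
  palette₀ (both-small bu bv) = inj₂ (bu , bv , refl)
  palette₀ (down _ _ ())
  palette₀ (up _ _ ())

  Uncrowded : Fin (suc k) → Fin N → Fin N → Set
  Uncrowded c s v = big s ≡ true × big v ≡ false × part s ⊙ cls v ≡ c
                  × (star v ≡ false → partDegree G big part v (part s) < Δ)

  palette₁ : ∀ {u v c} → View u v (suc zero , c) → Uncrowded c u v ⊎ Uncrowded c v u
  palette₁ (down bu bv (uncrowded d)) = inj₁ (bu , bv , refl , d)
  palette₁ (up bu bv (uncrowded d))   = inj₂ (bv , bu , refl , d)

  Crowded : Fin (suc k) → Fin N → Fin N → Set
  Crowded c s v = big s ≡ true × big v ≡ false × star v ≡ false
                × (Δ ≤ᵇ partDegree G big part v (part s)) ≡ true × slot v s ≡ c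

  palette₂ : ∀ {u v c} → View u v (suc (suc zero) , c) → Crowded c u v ⊎ Crowded c v u
  palette₂ (down bu bv (crowded st cr)) = inj₁ (bu , bv , st , cr , refl)
  palette₂ (up bu bv (crowded st cr))   = inj₂ (bv , bu , st , cr , refl)

-- Absence of monochromatic copies.

module NoMonochromaticCopy {N} {G : Graph N} {k m Δ : ℕ} (S : Scheme G k m Δ)
  {n} {H : Graph n} (connected : Graph.Connected H)
  (side : Fin n → Bool) (cross : ∀ {u v} → Graph._~_ H u v → side v ≡ not (side u))
  {h h′ : Fin n} (h-side : side h ≡ true) (h′-side : side h′ ≡ false)
  (2≤Δ : 2 ≤ Δ) (Δ≤degree : Δ ≤ count (adjacent H h)) (2≤degree : 2 ≤ count (adjacent H h′))
  (m<side : m < count side) (copy : Copy H G) where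
  open Scheme S
  open Colouring S
  open Graph H using (_~_)
  open Copy copy renaming (vertex to φ)

  too-many : (P : Fin N → Bool) → count P ≤ m → (∀ x → side x ≡ true → P (φ x) ≡ true) → ⊥
  too-many P P≤m within = <⇒≱ m<side
    (≤-trans (count-injection {P = side} {Q = P} φ within (λ _ _ → injective)) P≤m)

  -- Along an edge `f y` is determined as `f x ⊙ c`, so on a walk from `h` the values alternate
  -- between `f h` and `f h ⊙ c`, in step with the sides.
  constant-on-side : ∀ {c} (f : Fin n → Fin (suc k)) → (∀ {x y} → x ~ y → f x ⊙ f y ≡ c) →
    ∀ x → side x ≡ true → f x ≡ f h
  constant-on-side {c} f edges x x-side =
    trans (along-walk H (λ x → f x ≡ expected (side x)) step (connected h x) (sym (cong expected h-side)))
          (cong expected x-side)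
    where
    expected : Bool → Fin (suc k)
    expected b = if b then f h else f h ⊙ c
    toggle : ∀ b → expected b ⊙ c ≡ expected (not b)
    toggle true  = refl
    toggle false = trans (⊙-comm (f h ⊙ c) c) (trans (cong (c ⊙_) (⊙-comm (f h) c)) (⊙-involutive c (f h)))
    step : ∀ {x y} → x ~ y → f x ≡ expected (side x) → f y ≡ expected (side y)
    step {x} {y} x~y fx = begin
      f y                      ≡⟨ ⊙-involutive (f x) (f y) ⟨
      f x ⊙ (f x ⊙ f y)        ≡⟨ cong₂ _⊙_ fx (edges x~y) ⟩
      expected (side x) ⊙ c    ≡⟨ toggle (side x) ⟩
      expected (not (side x))  ≡⟨ cong expected (cross x~y) ⟨
      expected (side y)        ∎
      where open ≡-Reasoning

  -- A connected bipartite graph has only one proper 2-colouring up to exchanging the colours.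
  flips-with-side : (g : Fin n → Bool) → (∀ {x y} → x ~ y → g y ≡ not (g x)) →
    ∀ x → g x ≡ (if side x then g h else not (g h))
  flips-with-side g flip x =
    along-walk H (λ x → g x ≡ expected (side x)) step (connected h x) (sym (cong expected h-side))
    where
    expected : Bool → Bool
    expected b = if b then g h else not (g h)
    toggle : ∀ b → not (expected b) ≡ expected (not b)
    toggle true  = refl
    toggle false = not-involutive (g h)
    step : ∀ {x y} → x ~ y → g x ≡ expected (side x) → g y ≡ expected (side y)
    step {x} {y} x~y gx = trans (flip x~y) (trans (cong not gx) (trans (toggle (side x)) (sym (cong expected (cross x~y)))))

  neighbour : ∃[ y ] h ~ y
  neighbour = let y , h~y = count≥1⇒∃ (adjacent H h) (≤-trans (s≤s z≤n) (≤-trans 2≤Δ Δ≤degree))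
              in y , adjacent⇒~ H h~y

  Δ≤count : (P : Fin N → Bool) → (∀ {y} → h ~ y → P (φ y) ≡ true) → Δ ≤ count P
  Δ≤count P within = ≤-trans Δ≤degree
    (count-injection {P = adjacent H h} {Q = P} φ (λ _ → within ∘ adjacent⇒~ H) (λ _ _ → injective))

  module _ {c : Fin (suc k)} where

    -- Edges of palette 0 never change size, so connectivity spreads bigness from `φ h`. If it is
    -- big, the side falls into one part, which is too small; if it is small, its neighbours in the
    -- copy give it `Δ` edges of one `χ`-colour.
    avoids₀ : ¬ (∀ {x y} → x ~ y → col (φ x) (φ y) ≡ (zero , c))
    avoids₀ mono with big (φ h) in bh
    ... | true = too-many (λ s → big s ∧ (part s == part (φ h))) (part-fibre (part (φ h)))
        λ x x-side → ∧-true (all-big x)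
          (trans (cong (_== part (φ h)) (constant-on-side (part ∘ φ) edges x x-side)) (==-refl (part (φ h))))
      where
      edge₀ : ∀ {x y} → x ~ y → _
      edge₀ {x} {y} x~y = palette₀ (subst (View (φ x) (φ y)) (mono x~y) (view (φ x) (φ y)))
      all-big : ∀ x → big (φ x) ≡ true
      all-big x = along-walk H (λ x → big (φ x) ≡ true) step (connected h x) bh
        where
        step : ∀ {x y} → x ~ y → big (φ x) ≡ true → big (φ y) ≡ true
        step x~y bx with edge₀ x~y
        ... | inj₁ (_ , by , _)   = by
        ... | inj₂ (¬bx , _ , _) = case trans (sym bx) ¬bx of λ ()
      edges : ∀ {x y} → x ~ y → part (φ x) ⊙ part (φ y) ≡ c
      edges {x} x~y with edge₀ x~y
      ... | inj₁ (_ , _ , eq)   = eq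
      ... | inj₂ (¬bx , _ , _) = case trans (sym (all-big x)) ¬bx of λ ()
    ... | false = <⇒≱ (χ-bound (φ h) c)
        (Δ≤count (λ u → smallAdj G big (φ h) u ∧ (χ (φ h) u == c)) within)
      where
      within : ∀ {y} → h ~ y → smallAdj G big (φ h) (φ y) ∧ (χ (φ h) (φ y) == c) ≡ true
      within {y} h~y with palette₀ (subst (View (φ h) (φ y)) (mono h~y) (view (φ h) (φ y)))
      ... | inj₁ (bh′ , _ , _)    = case trans (sym bh′) bh of λ ()
      ... | inj₂ (_ , ¬by , refl) =
        ∧-true (∧-true (~⇒adjacent G (edge h~y)) (∧-true (cong not bh) (cong not ¬by))) (==-refl (χ (φ h) (φ y)))

    -- Size alternates with the side, so `kind`, the part at big and the class at small vertices, is
    -- constant on the given side. One part or one starred class is too small. If `φ h` is small and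
    -- unstarred, cancellation puts all its copied neighbours into one part, which is uncrowded yet
    -- receives `Δ` of them.
    avoids₁ : ¬ (∀ {x y} → x ~ y → col (φ x) (φ y) ≡ (suc zero , c))
    avoids₁ mono = by-size (big (φ h)) refl
      where
      edge₁ : ∀ {x y} → x ~ y → Uncrowded c (φ x) (φ y) ⊎ Uncrowded c (φ y) (φ x)
      edge₁ {x} {y} x~y = palette₁ (subst (View (φ x) (φ y)) (mono x~y) (view (φ x) (φ y)))
      flip : ∀ {x y} → x ~ y → big (φ y) ≡ not (big (φ x))
      flip x~y with edge₁ x~y
      ... | inj₁ (bx , by , _) = trans by (sym (cong not bx))
      ... | inj₂ (by , bx , _) = trans by (sym (cong not bx))
      same-size : ∀ x → side x ≡ true → big (φ x) ≡ big (φ h)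
      same-size x x-side = trans (flips-with-side (big ∘ φ) flip x)
        (cong (λ b → if b then big (φ h) else not (big (φ h))) x-side)
      kind : Bool → Fin N → Fin (suc k)
      kind b v = if b then part v else cls v
      edges : ∀ {x y} → x ~ y → kind (big (φ x)) (φ x) ⊙ kind (big (φ y)) (φ y) ≡ c
      edges {x} {y} x~y with edge₁ x~y
      ... | inj₁ (bx , by , eq , _) = trans (cong₂ (λ b b′ → kind b (φ x) ⊙ kind b′ (φ y)) bx by) eq
      ... | inj₂ (by , bx , eq , _) = trans (cong₂ (λ b b′ → kind b (φ x) ⊙ kind b′ (φ y)) bx by)
                                            (trans (⊙-comm (cls (φ x)) (part (φ y))) eq)
      same-kind : ∀ {b} → big (φ h) ≡ b → ∀ x → side x ≡ true → kind b (φ x) ≡ kind b (φ h)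
      same-kind refl x x-side =
        trans (cong (λ b → kind b (φ x)) (sym (same-size x x-side)))
              (constant-on-side (λ x → kind (big (φ x)) (φ x)) edges x x-side)
      by-star : big (φ h) ≡ false → ∀ b → star (φ h) ≡ b → ⊥
      by-star ¬bh true st = too-many (λ v → star v ∧ (cls v == cls (φ h))) (cls-fibre (cls (φ h)))
        λ x x-side → ∧-true
          -- An unstarred vertex has class `zero`, but the class shared by the side is that of the
          -- starred `φ h`, hence nonzero.
          (¬-not λ ¬sx → proj₂ cls≡0⇔unstarred st
            (trans (sym (same-kind ¬bh x x-side)) (proj₁ cls≡0⇔unstarred ¬sx)))
          (trans (cong (_== cls (φ h)) (same-kind ¬bh x x-side)) (==-refl (cls (φ h))))
      by-star ¬bh false ¬st = <⇒≱ bounded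
        (Δ≤count (λ s → (part s == part (φ y₀)) ∧ smallToBig G big (φ h) s) within)
        where
        y₀ : Fin n
        y₀ = proj₁ neighbour
        at-h : ∀ {y} → h ~ y → Uncrowded c (φ y) (φ h)
        at-h h~y with edge₁ h~y
        ... | inj₁ (bh , _) = case trans (sym bh) ¬bh of λ ()
        ... | inj₂ u        = u
        bounded : partDegree G big part (φ h) (part (φ y₀)) < Δ
        bounded = let _ , _ , _ , d = at-h (proj₂ neighbour) in d ¬st
        within : ∀ {y} → h ~ y → (part (φ y) == part (φ y₀)) ∧ smallToBig G big (φ h) (φ y) ≡ true
        within {y} h~y =
          let by , _ , eq  , _ = at-h h~y
              _  , _ , eq₀ , _ = at-h (proj₂ neighbour)
          in ∧-true (trans (cong (_== part (φ y₀)) (⊙-cancelʳ (cls (φ h)) (trans eq (sym eq₀)))) (==-refl (part (φ y₀))))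
               (∧-true (cong not ¬bh) (∧-true by (~⇒adjacent G (edge h~y))))
      by-size : ∀ b → big (φ h) ≡ b → ⊥
      by-size true bh = too-many (λ s → big s ∧ (part s == part (φ h))) (part-fibre (part (φ h)))
        λ x x-side → ∧-true (trans (same-size x x-side) bh)
          (trans (cong (_== part (φ h)) (same-kind bh x x-side)) (==-refl (part (φ h))))
      by-size false ¬bh = by-star ¬bh (star (φ h)) refl

    -- Size alternates with the side, so one of `φ h` and `φ h′` is small. It has two copied
    -- neighbours, both crowded and with the same slot, against injectivity of `slot`.
    avoids₂ : ¬ (∀ {x y} → x ~ y → col (φ x) (φ y) ≡ (suc (suc zero) , c))
    avoids₂ mono = by-size (big (φ h)) refl
      where
      edge₂ : ∀ {x y} → x ~ y → Crowded c (φ x) (φ y) ⊎ Crowded c (φ y) (φ x)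
      edge₂ {x} {y} x~y = palette₂ (subst (View (φ x) (φ y)) (mono x~y) (view (φ x) (φ y)))
      flip : ∀ {x y} → x ~ y → big (φ y) ≡ not (big (φ x))
      flip x~y with edge₂ x~y
      ... | inj₁ (bx , by , _) = trans by (sym (cong not bx))
      ... | inj₂ (by , bx , _) = trans by (sym (cong not bx))
      small-branching : ∀ t → big (φ t) ≡ false → 2 ≤ count (adjacent H t) → ⊥
      small-branching t ¬bt 2≤ with count≥2⇒∃₂ (adjacent H t) 2≤
      ... | y , z , ty , tz , y≢z =
        let _ , _ , st , _ , sy = at-t (adjacent⇒~ H ty)
            _ , _ , _  , _ , sz = at-t (adjacent⇒~ H tz)
        in y≢z (injective (slot-injective st (crowding ty) (crowding tz) (trans sy (sym sz))))
        where
        at-t : ∀ {y} → t ~ y → Crowded c (φ y) (φ t)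
        at-t t~y with edge₂ t~y
        ... | inj₁ (bt , _) = case trans (sym bt) ¬bt of λ ()
        ... | inj₂ cr       = cr
        crowding : ∀ {y} → adjacent H t y ≡ true → crowdedNeighbour G big part Δ (φ t) (φ y) ≡ true
        crowding ty = let by , _ , _ , cr , _ = at-t (adjacent⇒~ H ty)
          in ∧-true (∧-true (cong not ¬bt) (∧-true by (~⇒adjacent G (edge (adjacent⇒~ H ty))))) cr
      by-size : ∀ b → big (φ h) ≡ b → ⊥
      by-size false ¬bh = small-branching h ¬bh (≤-trans 2≤Δ Δ≤degree)
      by-size true  bh  = small-branching h′
        (trans (flips-with-side (big ∘ φ) flip h′)
          (cong₂ (λ s b → if s then b else not b) h′-side bh)) 2≤degree

  avoids : ∀ pc → ¬ (∀ {x y} → x ~ y → col (φ x) (φ y) ≡ pc)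
  avoids (zero , c)           = avoids₀
  avoids (suc zero , c)       = avoids₁
  avoids (suc (suc zero) , c) = avoids₂

-- Arithmetic and the lower bound.

module _ {r n : ℕ} {H : Graph n} (connected : Graph.Connected H)
  (side : Fin n → Bool) (cross : ∀ {u v} → Graph._~_ H u v → side v ≡ not (side u))
  {h h′ : Fin n} (h-side : side h ≡ true) (h′-side : side h′ ≡ false) where

  scheme⇒¬arrows : ∀ {N} {G : Graph N} {k m Δ} → Scheme G k m Δ → 3 * suc k ≤ r →
    2 ≤ Δ → Δ ≤ count (adjacent H h) → 2 ≤ count (adjacent H h′) → m < count side → ¬ Arrows r G H
  scheme⇒¬arrows {N} {G} {k} S 3K≤r 2≤Δ Δ≤degree 2≤degree m<side arrows =
    -- The common colour in `Fin r` is pulled back to a palette and an entry by reading it off an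
    -- actual edge at `h`.
    avoids (col (φ h) (φ (proj₁ neighbour))) λ x~y →
      embed-injective (trans (proj₂ (proj₂ mono) x~y) (sym (proj₂ (proj₂ mono) (proj₂ neighbour))))
    where
    open Colouring S
    embed : Fin 3 × Fin (suc k) → Fin r
    embed (p , c) = inject≤ (combine p c) 3K≤r
    embed-injective : ∀ {x y} → embed x ≡ embed y → x ≡ y
    embed-injective eq = let p≡ , c≡ = Fin.combine-injective _ _ _ _ (Fin.inject≤-injective 3K≤r 3K≤r _ _ eq)
                         in cong₂ _,_ p≡ c≡
    colouring : EdgeColouring r G
    colouring = record
      { colour = λ {u} {v} _ → embed (col u v)
      ; colour-sym = λ {u} {v} _ _ → cong embed (col-sym u v) }
    mono : Σ[ φ ∈ Copy H G ] Monochromatic colouring φ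
    mono = arrows colouring
    open Copy (proj₁ mono) renaming (vertex to φ)
    open NoMonochromaticCopy S connected side cross h-side h′-side 2≤Δ Δ≤degree 2≤degree m<side (proj₁ mono)

  -- With `q = r / 3` colours in each palette, `r ≤ 4 * q`, so `r * r` costs a factor 16 against
  -- `q * q`; this gives 1152 as 16 times 72.
  side-bound : 6 ≤ r → ∀ {Δ} → 2 ≤ Δ → Δ ≤ count (adjacent H h) → 2 ≤ count (adjacent H h′) → 2 ≤ count side →
    ∀ {N} (G : Graph N) → Arrows r G H → r * r * (count side * Δ) ≤ 1152 * Graph.edgeCount G
  side-bound 6≤r {Δ} 2≤Δ Δ≤degree 2≤degree 2≤side G arrows = ≮⇒≥ λ sparse →
    scheme⇒¬arrows (scheme-for sparse) 3K≤r 2≤Δ Δ≤degree 2≤degree m<side arrows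
    where
    open ≤-Reasoning
    q k₂ m₂ E : ℕ
    q = r / 3
    k₂ = q ∸ 2
    m₂ = count side ∸ 2
    E = Graph.edgeCount G
    3q≤r : q * 3 ≤ r
    3q≤r = ≤-trans (m≤n+m (q * 3) (r % 3)) (≤-reflexive (sym (m≡m%n+[m/n]*n r 3)))
    r≤2+3q : r ≤ 2 + q * 3
    r≤2+3q = ≤-trans (≤-reflexive (m≡m%n+[m/n]*n r 3)) (+-monoˡ-≤ (q * 3) (s≤s⁻¹ (m%n<n r 3)))
    2≤q : 2 ≤ q
    2≤q = *-cancelʳ-< 3 1 q (+-cancelˡ-< 2 3 (q * 3) (≤-trans 6≤r r≤2+3q))
    K≡q : 2 + k₂ ≡ q
    K≡q = m+[n∸m]≡n 2≤q
    a≡ : 2 + m₂ ≡ count side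
    a≡ = m+[n∸m]≡n 2≤side
    3K≤r : 3 * (2 + k₂) ≤ r
    3K≤r = ≤-trans (≤-reflexive (trans (cong (3 *_) K≡q) (*-comm 3 q))) 3q≤r
    m<side : suc m₂ < count side
    m<side = ≤-reflexive a≡
    -- The remainder modulo 3 is at most 2, and `2 ≤ q` because `6 ≤ r`.
    r≤4q : r ≤ 4 * q
    r≤4q = begin
      r          ≤⟨ r≤2+3q ⟩
      2 + q * 3  ≤⟨ +-monoˡ-≤ (q * 3) 2≤q ⟩
      q + q * 3  ≡⟨ cong (q +_) (*-comm q 3) ⟩
      4 * q      ∎
    scheme-for : 1152 * E < r * r * (count side * Δ) → Scheme G (suc k₂) (suc m₂) Δ
    scheme-for sparse = Construction.scheme G k₂ m₂ Δ 2≤Δ (*-cancelˡ-< 16 _ _ (begin-strict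
      16 * (72 * E)                                   ≡⟨ *-assoc 16 72 E ⟨
      1152 * E                                        <⟨ sparse ⟩
      r * r * (count side * Δ)                        ≤⟨ *-monoˡ-≤ (count side * Δ) (*-mono-≤ r≤4q r≤4q) ⟩
      4 * q * (4 * q) * (count side * Δ)              ≡⟨ regroup q (count side * Δ) ⟩
      16 * (q * q * (count side * Δ))                 ≡⟨ cong₂ (λ x y → 16 * (x * x * (y * Δ))) K≡q a≡ ⟨
      16 * ((2 + k₂) * (2 + k₂) * ((2 + m₂) * Δ))     ∎))
      where
      regroup : ∀ q z → 4 * q * (4 * q) * z ≡ 16 * (q * q * z)
      regroup = solve-∀

module _ {r m N : ℕ} (6≤r : 6 ≤ r) {H : Graph (2 + m)} (connected : Graph.Connected H) (¬star : ¬ IsStar H)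
  {G : Graph N} (arrows : Arrows r G H) where
  open Graph H using (_~_; degree; maxDegreeIn)

  -- The complement `W` is a separate argument so that the bound applies to both orders of the
  -- sides. As `H` is not a star, each side has two vertices, and a walk between them yields a
  -- branching vertex on the opposite side: in `V` it shows `2 ≤ Δ`, in `W` it is the vertex `h′`
  -- needed against palette 2.
  part-bound : (V W : Subset (2 + m)) → (∀ x → lookup W x ≡ not (lookup V x)) →
    (∀ {u v} → u ~ v → lookup V v ≡ not (lookup V u)) →
    r * r * (∣ V ∣ * maxDegreeIn V) ≤ 1152 * Graph.edgeCount G
  part-bound V W W≡¬V cross = subst (λ a → r * r * (a * Δ) ≤ 1152 * Graph.edgeCount G) (sym (∣∣≡count V))
    (side-bound connected (lookup V) cross
      ([]=⇒lookup (proj₁ (proj₂ attained))) (trans (sym (not-involutive _)) (cong not (trans (sym (W≡¬V _)) (proj₁ (proj₂ h′)))))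
      6≤r 2≤Δ (≤-reflexive (trans (sym (proj₂ (proj₂ attained))) (degree≡count H _)))
      (≤-trans (proj₂ (proj₂ h′)) (≤-reflexive (degree≡count H _)))
      (both-sides≥2 H connected (lookup V) cross ¬star) G arrows)
    where
    Δ : ℕ
    Δ = maxDegreeIn V
    V≡¬W : ∀ x → lookup V x ≡ not (lookup W x)
    V≡¬W x = trans (sym (not-involutive (lookup V x))) (cong not (sym (W≡¬V x)))
    crossW : ∀ {u v} → u ~ v → lookup W v ≡ not (lookup W u)
    crossW {u} {v} u~v = trans (W≡¬V v) (cong not (trans (cross u~v) (sym (W≡¬V u))))
    branching : (V W : Subset (2 + m)) → (∀ x → lookup V x ≡ not (lookup W x)) →
      (∀ {u v} → u ~ v → lookup V v ≡ not (lookup V u)) → (∀ {u v} → u ~ v → lookup W v ≡ not (lookup W u)) →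
      ∃[ h ] (lookup V h ≡ true × 2 ≤ degree h)
    branching V W V≡¬W crossV crossW =
      let y , y′ , wy , wy′ , y≢y′ = count≥2⇒∃₂ (lookup W) (both-sides≥2 H connected (lookup W) crossW ¬star)
      in branching-vertex H (lookup V) crossV (trans (V≡¬W y) (cong not wy)) (trans (V≡¬W y′) (cong not wy′))
           y≢y′ (connected y y′)
    h₀ : ∃[ h ] (lookup V h ≡ true × 2 ≤ degree h)
    h₀ = branching V W V≡¬W cross crossW
    h′ : ∃[ h ] (lookup W h ≡ true × 2 ≤ degree h)
    h′ = branching W V W≡¬V crossW cross
    2≤Δ : 2 ≤ Δ
    2≤Δ = ≤-trans (proj₂ (proj₂ h₀)) (degree≤maxDegreeIn H (lookup⇒[]= _ V (proj₁ (proj₂ h₀))))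
    attained : ∃[ h ] (h ∈ˢ V × degree h ≡ Δ)
    attained = maxDegreeIn-attained H V (≤-trans (s≤s z≤n) 2≤Δ)

x∈∁p⇒lookup≡false : ∀ {n} {p : Subset n} {x} → x ∈ˢ ∁ p → lookup p x ≡ false
x∈∁p⇒lookup≡false {p = p} {x} x∈∁p = ¬-not (x∈∁p⇒x∉p x∈∁p ∘ lookup⇒[]= x p)

bipartition-crosses : ∀ {n} {H : Graph n} (P : Bipartition H) → ∀ {u v} → Graph._~_ H u v →
  lookup (Bipartition.V₁ P) v ≡ not (lookup (Bipartition.V₁ P) u)
bipartition-crosses P u~v with Bipartition.crossing P u~v
... | inj₁ (u∈V₁ , v∈V₂) = trans (x∈∁p⇒lookup≡false v∈V₂) (cong not (sym ([]=⇒lookup u∈V₁)))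
... | inj₂ (u∈V₂ , v∈V₁) = trans ([]=⇒lookup v∈V₁) (cong not (sym (x∈∁p⇒lookup≡false u∈V₂)))

theorem1p2 : ∀ (r : ℕ) → 6 ≤ r →
    ∃[ n₀ ] (∀ (n : ℕ) → n₀ ≤ n →
    ∀ (H : Graph n) → Graph.Connected H → (P : Bipartition H) → ¬ IsStar H →
    -- Rᵣ(H) ≥ (r² / 2304) · β(H), with the denominator cleared
    ∀ (R : ℕ) → IsSizeRamseyNumber r H R → r ^ 2 * β H P ≤ 2304 * R)
-- Two vertices suffice: they provide the edge from which both sides are shown to be nonempty.
theorem1p2 r 6≤r = 2 , λ where
    (suc (suc m)) (s≤s (s≤s z≤n)) H connected P ¬star R isR →
      let open Graph H using (maxDegreeIn)
          open Bipartition P using (V₁; V₂)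
          N , G , arrows , edges≡R = IsSizeRamseyNumber.attained isR
          b₁ = ∣ V₁ ∣ * maxDegreeIn V₁
          b₂ = ∣ V₂ ∣ * maxDegreeIn V₂
          V₂≡¬V₁ : ∀ x → lookup V₂ x ≡ not (lookup V₁ x)
          V₂≡¬V₁ x = lookup-map x not V₁
          cross₁ : ∀ {u v} → Graph._~_ H u v → lookup V₁ v ≡ not (lookup V₁ u)
          cross₁ = bipartition-crosses P
      in begin
        r ^ 2 * (b₁ + b₂)                 ≡⟨ expand r b₁ b₂ ⟩
        r * r * b₁ + r * r * b₂
          -- The same `G` serves both sides, so the two bounds add up to twice 1152.
          ≤⟨ +-mono-≤ (part-bound 6≤r connected ¬star arrows V₁ V₂ V₂≡¬V₁ cross₁)
                      (part-bound 6≤r connected ¬star arrows V₂ V₁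
                        (λ x → trans (sym (not-involutive (lookup V₁ x))) (cong not (sym (V₂≡¬V₁ x))))
                        (λ {u} {v} u~v → trans (V₂≡¬V₁ v) (cong not (trans (cross₁ u~v) (sym (V₂≡¬V₁ u)))))) ⟩
        1152 * Graph.edgeCount G + 1152 * Graph.edgeCount G
                                          ≡⟨ *-distribʳ-+ (Graph.edgeCount G) 1152 1152 ⟨
        2304 * Graph.edgeCount G          ≡⟨ cong (2304 *_) edges≡R ⟩
        2304 * R                          ∎
  where
  open ≤-Reasoning
  -- `r * (r * 1)` is the normal form of `r ^ 2`.
  expand : ∀ r x y → r * (r * 1) * (x + y) ≡ r * r * x + r * r * y
  expand = solve-∀
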